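{- Let $k\ge 1$ and $n$ be integers, and let $H$ be the $k\times k$ complex matrix whose $i$-th row ($1\le i\le k$) is $v((n+k+i-1)_{k+1})-v((n+k+i-1)_{k})$. Then the nullity of $H$ equals the number of cycles (loops included) in the directed graph $G(n,k)$.
   Context: For an integer $\ell$, $\ell_k$ and $\ell_{k+1}$ denote the least nonnegative residues of $\ell$ modulo $k$ and $k+1$. Let $\xi$ be a complex primitive $(k+1)$-th root of unity and $v(\ell)=(\xi^{\ell},\xi^{2\ell},\dots,\xi^{k\ell})\in\mathbb{C}^k$. $G(n,k)$ is the directed graph on vertices $0,1,\dots,k$ whose edges are exactly the $k$ edges $E(i): (i+n-2)_{k+1}\to(i+n-1)_k$, $1\le i\le k$; equivalently $a\to b$ is an edge iff $v(a)-v(b)$ is a row of $H$. An edge $a\to a$ is a loop and counts as a cycle of length $1$. In the paper the nullity of $H$ equals $N(n,k)$, where for $n>k$, $N(n,k)$ is the nullity of the $n\times n$ skew-symmetric Toeplitz matrix $A(n,k)$ whose first $k$ superdiagonals have all entries $1$ and remaining superdiagonals all entries $0$. -}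

module Defs where

open import Algebra.Bundles using (RawRing)
open import Data.Fin.Base using (Fin; toℕ)
open import Data.Integer.Base as ℤ using (ℤ; +_; _%ℕ_)
open import Data.Nat.Base as ℕ using (ℕ; suc; NonZero)
open import Data.Nat.DivMod using (_mod_)
import Data.Nat.Properties as ℕ
open import Data.Product.Base using (Σ-syntax; ∃-syntax; _×_; _,_)
open import Data.Rational.Base using (ℚ; 0ℚ; 1ℚ; ½; _+_; _*_; _-_; -_; 1/_; ∣_∣; _<_; _≤_; Positive; positive) renaming (NonZero to ℚNonZero)
open import Data.Rational.Properties
open import Data.Rational.Solver using (module +-*-Solver)
open import Data.Vec.Functional using (Vector)
open import Function.Definitions using (Injective)
open import Level using (0ℓ)
open import Relation.Binary.Core using (Rel)
open import Relation.Binary.PropositionalEquality using (_≡_; refl; sym; cong; subst)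
open import Relation.Nullary.Negation using (¬_)

-- Real numbers are Cauchy sequences of rationals, up to null sequences.

IsCauchy : (ℕ → ℚ) → Set
IsCauchy x = ∀ ε → 0ℚ < ε → ∃[ N ] ∀ m n → N ℕ.≤ m → N ℕ.≤ n → ∣ x m - x n ∣ < ε

record ℝ : Set where
  constructor mkℝ
  field
    seq    : ℕ → ℚ
    cauchy : IsCauchy seq

open ℝ public

infix 4 _≈ℝ_

_≈ℝ_ : Rel ℝ 0ℓ
x ≈ℝ y = ∀ ε → 0ℚ < ε → ∃[ N ] ∀ n → N ℕ.≤ n → ∣ seq x n - seq y n ∣ < ε

module CauchyClosure where
  private module S = +-*-Solver
  open S using (_:=_; _:+_; _:*_; :-_; con)

  abstract
    half-pos : ∀ {ε} → 0ℚ < ε → 0ℚ < ε * ½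
    half-pos {ε} ε>0 =
      positive⁻¹ (ε * ½) {{pos*pos⇒pos ε {{positive ε>0}} ½}}

    half+half : ∀ ε → ε * ½ + ε * ½ ≡ ε
    half+half = S.solve 1 (λ ε → ε :* con ½ :+ ε :* con ½ := ε) refl

    const-cauchy : ∀ q → IsCauchy (λ _ → q)
    const-cauchy q ε ε>0 = 0 , λ _ _ _ _ →
      subst (_< ε) (sym (cong ∣_∣ (+-inverseʳ q))) ε>0

    +-cauchy : ∀ {x y} → IsCauchy x → IsCauchy y → IsCauchy (λ n → x n + y n)
    +-cauchy {x} {y} cx cy ε ε>0
      with M , p ← cx (ε * ½) (half-pos ε>0)
         | N , q ← cy (ε * ½) (half-pos ε>0)
      = M ℕ.⊔ N , λ m n l₁ l₂ → begin-strict
        ∣ (x m + y m) - (x n + y n) ∣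
          ≡⟨ cong ∣_∣ (rearrange (x m) (y m) (x n) (y n)) ⟩
        ∣ (x m - x n) + (y m - y n) ∣
          ≤⟨ ∣p+q∣≤∣p∣+∣q∣ (x m - x n) (y m - y n) ⟩
        ∣ x m - x n ∣ + ∣ y m - y n ∣
          <⟨ +-mono-< (p m n (ℕ.m⊔n≤o⇒m≤o M N l₁) (ℕ.m⊔n≤o⇒m≤o M N l₂))
                      (q m n (ℕ.m⊔n≤o⇒n≤o M N l₁) (ℕ.m⊔n≤o⇒n≤o M N l₂)) ⟩
        ε * ½ + ε * ½ ≡⟨ half+half ε ⟩
        ε ∎
      where
      open ≤-Reasoning
      rearrange : ∀ a b c d → (a + b) - (c + d) ≡ (a - c) + (b - d)
      rearrange = S.solve 4 (λ a b c d →
        (a :+ b) :+ (:- (c :+ d)) := (a :+ (:- c)) :+ (b :+ (:- d))) refl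

    neg-cauchy : ∀ {x} → IsCauchy x → IsCauchy (λ n → - x n)
    neg-cauchy {x} cx ε ε>0 with N , p ← cx ε ε>0 = N , λ m n l₁ l₂ →
      subst (_< ε) (sym (cong ∣_∣ (rearrange (x m) (x n)))) (subst (_< ε) (sym (∣-p∣≡∣p∣ (x m - x n))) (p m n l₁ l₂))
      where
      rearrange : ∀ a b → (- a) - (- b) ≡ - (a - b)
      rearrange = S.solve 2 (λ a b → (:- a) :+ (:- (:- b)) := :- (a :+ (:- b))) refl

    eventually-bounded : ∀ {x} → IsCauchy x →
      ∃[ B ] 0ℚ < B × ∃[ N ] ∀ n → N ℕ.≤ n → ∣ x n ∣ ≤ B
    eventually-bounded {x} cx with N , p ← cx 1ℚ (positive⁻¹ 1ℚ) =
      1ℚ + ∣ x N ∣ , +-mono-<-≤ (positive⁻¹ 1ℚ) (0≤∣p∣ (x N)) , N , λ n N≤n → begin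
        ∣ x n ∣                   ≡⟨ cong ∣_∣ (rearrange (x n) (x N)) ⟩
        ∣ (x n - x N) + x N ∣     ≤⟨ ∣p+q∣≤∣p∣+∣q∣ (x n - x N) (x N) ⟩
        ∣ x n - x N ∣ + ∣ x N ∣   ≤⟨ +-monoˡ-≤ ∣ x N ∣ (<⇒≤ (p n N N≤n ℕ.≤-refl)) ⟩
        1ℚ + ∣ x N ∣              ∎
      where
      open ≤-Reasoning
      rearrange : ∀ a b → a ≡ (a - b) + b
      rearrange = S.solve 2 (λ a b → a := (a :+ (:- b)) :+ b) refl

    small-product : ∀ {B ε} → 0ℚ < B → 0ℚ < ε →
      ∃[ δ ] 0ℚ < δ × (∀ p q → ∣ p ∣ ≤ B → ∣ q ∣ < δ → ∣ p * q ∣ < ε)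
    small-product {B} {ε} B>0 ε>0 = ε * B⁻¹ , δ>0 , λ p q p≤B q<δ → begin-strict
        ∣ p * q ∣       ≡⟨ ∣p*q∣≡∣p∣*∣q∣ p q ⟩
        ∣ p ∣ * ∣ q ∣   ≤⟨ *-monoʳ-≤-nonNeg ∣ q ∣ {{∣-∣-nonNeg q}} p≤B ⟩
        B * ∣ q ∣       <⟨ *-monoʳ-<-pos B q<δ ⟩
        B * (ε * B⁻¹)   ≡⟨ rearrange B ε B⁻¹ ⟩
        ε * (B * B⁻¹)   ≡⟨ cong (ε *_) (*-inverseʳ B) ⟩
        ε * 1ℚ          ≡⟨ *-identityʳ ε ⟩
        ε               ∎
      where
      open ≤-Reasoning
      instance
        B-pos : Positive B
        B-pos = positive B>0
        B≢0 : ℚNonZero B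
        B≢0 = pos⇒nonZero B
      B⁻¹ : ℚ
      B⁻¹ = 1/ B
      δ>0 : 0ℚ < ε * B⁻¹
      δ>0 = positive⁻¹ (ε * B⁻¹) {{pos*pos⇒pos ε {{positive ε>0}} B⁻¹ {{1/pos⇒pos B}}}}
      rearrange : ∀ a b c → a * (b * c) ≡ b * (a * c)
      rearrange = S.solve 3 (λ a b c → a :* (b :* c) := b :* (a :* c)) refl

    product-difference : ∀ a b c d ε → ∣ a * (b - d) ∣ < ε * ½ → ∣ d * (a - c) ∣ < ε * ½ →
      ∣ a * b - c * d ∣ < ε
    product-difference a b c d ε p q = begin-strict
        ∣ a * b - c * d ∣                   ≡⟨ cong ∣_∣ (rearrange a b c d) ⟩
        ∣ a * (b - d) + d * (a - c) ∣       ≤⟨ ∣p+q∣≤∣p∣+∣q∣ (a * (b - d)) (d * (a - c)) ⟩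
        ∣ a * (b - d) ∣ + ∣ d * (a - c) ∣   <⟨ +-mono-< p q ⟩
        ε * ½ + ε * ½                       ≡⟨ half+half ε ⟩
        ε                                   ∎
      where
      open ≤-Reasoning
      rearrange : ∀ a b c d → a * b - c * d ≡ a * (b - d) + d * (a - c)
      rearrange = S.solve 4 (λ a b c d →
        (a :* b) :+ (:- (c :* d)) :=
        (a :* (b :+ (:- d))) :+ (d :* (a :+ (:- c)))) refl

    *-cauchy : ∀ {x y} → IsCauchy x → IsCauchy y → IsCauchy (λ n → x n * y n)
    *-cauchy {x} {y} cx cy ε ε>0 =
      let A , A>0 , M₁ , boundx = eventually-bounded {x} cx
          B , B>0 , N₁ , boundy = eventually-bounded {y} cy
          α , α>0 , smallx = small-product B>0 (half-pos ε>0)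
          β , β>0 , smally = small-product A>0 (half-pos ε>0)
          M₂ , p = cx α α>0
          N₂ , q = cy β β>0
          K₁ = M₁ ℕ.⊔ N₁
          K₂ = M₂ ℕ.⊔ N₂
      in K₁ ℕ.⊔ K₂ , λ m n K≤m K≤n →
        let K₁≤m = ℕ.m⊔n≤o⇒m≤o K₁ K₂ K≤m
            K₂≤m = ℕ.m⊔n≤o⇒n≤o K₁ K₂ K≤m
            K₁≤n = ℕ.m⊔n≤o⇒m≤o K₁ K₂ K≤n
            K₂≤n = ℕ.m⊔n≤o⇒n≤o K₁ K₂ K≤n
        in product-difference (x m) (y m) (x n) (y n) ε
             (smally (x m) (y m - y n) (boundx m (ℕ.m⊔n≤o⇒m≤o M₁ N₁ K₁≤m))
               (q m n (ℕ.m⊔n≤o⇒n≤o M₂ N₂ K₂≤m) (ℕ.m⊔n≤o⇒n≤o M₂ N₂ K₂≤n)))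
             (smallx (y n) (x m - x n) (boundy n (ℕ.m⊔n≤o⇒n≤o M₁ N₁ K₁≤n))
               (p m n (ℕ.m⊔n≤o⇒m≤o M₂ N₂ K₂≤m) (ℕ.m⊔n≤o⇒m≤o M₂ N₂ K₂≤n)))

open CauchyClosure

infixl 6 _+ℝ_ _-ℝ_
infixl 7 _*ℝ_
infix  8 -ℝ_

fromℚ : ℚ → ℝ
fromℚ q = mkℝ (λ _ → q) (const-cauchy q)

_+ℝ_ _*ℝ_ : ℝ → ℝ → ℝ
x +ℝ y = mkℝ (λ n → seq x n + seq y n) (+-cauchy {seq x} {seq y} (cauchy x) (cauchy y))
x *ℝ y = mkℝ (λ n → seq x n * seq y n) (*-cauchy {seq x} {seq y} (cauchy x) (cauchy y))

-ℝ_ : ℝ → ℝ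
-ℝ x = mkℝ (λ n → - seq x n) (neg-cauchy {seq x} (cauchy x))

_-ℝ_ : ℝ → ℝ → ℝ
x -ℝ y = x +ℝ (-ℝ y)

record ℂ : Set where
  constructor _+i_
  field
    re im : ℝ

open ℂ public

infix 4 _≈ℂ_

_≈ℂ_ : Rel ℂ 0ℓ
z ≈ℂ w = re z ≈ℝ re w × im z ≈ℝ im w

ℂ-rawRing : RawRing 0ℓ 0ℓ
ℂ-rawRing = record
  { Carrier = ℂ
  ; _≈_     = _≈ℂ_
  ; _+_     = λ z w → (re z +ℝ re w) +i (im z +ℝ im w)
  ; _*_     = λ z w → (re z *ℝ re w -ℝ im z *ℝ im w)
                   +i (re z *ℝ im w +ℝ im z *ℝ re w)
  ; -_      = λ z → (-ℝ re z) +i (-ℝ im z)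
  ; 0#      = fromℚ 0ℚ +i fromℚ 0ℚ
  ; 1#      = fromℚ 1ℚ +i fromℚ 0ℚ
  }

open RawRing ℂ-rawRing public using (0#; 1#) renaming (_+_ to _+ℂ_; _*_ to _*ℂ_; -_ to -ℂ_)
open import Algebra.Definitions.RawSemiring (RawRing.rawSemiring ℂ-rawRing) public using (_^_; sum)

infixl 6 _-ℂ_

_-ℂ_ : ℂ → ℂ → ℂ
z -ℂ w = z +ℂ (-ℂ w)

IsPrimitiveRoot : ℕ → ℂ → Set
IsPrimitiveRoot m ξ =
  ξ ^ m ≈ℂ 1# × (∀ j → 0 ℕ.< j → j ℕ.< m → ¬ ξ ^ j ≈ℂ 1#)

Matrix : ℕ → ℕ → Set
Matrix m n = Fin m → Fin n → ℂ

InKernel : ∀ {m n} → Matrix m n → Vector ℂ n → Set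
InKernel A x = ∀ i → sum (λ j → A i j *ℂ x j) ≈ℂ 0#

lincomb : ∀ {d n} → Vector ℂ d → (Fin d → Vector ℂ n) → Vector ℂ n
lincomb c b j = sum (λ i → c i *ℂ b i j)

record IsBasis {n d} (V : Vector ℂ n → Set) (b : Fin d → Vector ℂ n) : Set where
  field
    member      : ∀ i → V (b i)
    independent : ∀ c → (∀ j → lincomb c b j ≈ℂ 0#) → ∀ i → c i ≈ℂ 0#
    spanning    : ∀ x → V x → ∃[ c ] ∀ j → x j ≈ℂ lincomb c b j

-- Nullity is the dimension of the right kernel; being a dimension over ℂ, it
-- is given as a relation, `the kernel has a basis of d vectors'.
HasNullity : ∀ {m n} → Matrix m n → ℕ → Set
HasNullity {n = n} A d = Σ[ b ∈ (Fin d → Vector ℂ n) ] IsBasis (InKernel A) b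

module _ {V : Set} (_⟶_ : Rel V 0ℓ) where

  -- Size 1 is allowed, so a loop a ⟶ a is a cycle.
  record Cycle : Set where
    field
      size             : ℕ
      {{size-nonZero}} : NonZero size
      vertex           : Fin size → V
      distinct         : Injective _≡_ _≡_ vertex

    at : ℕ → V
    at i = vertex (i mod size)

    field
      edge : ∀ i → at i ⟶ at (suc i)

  open Cycle

  -- Equality up to the choice of starting vertex. The sizes then agree
  -- automatically: by distinctness, the size is the least period of `at`.
  SameCycle : Rel Cycle 0ℓ
  SameCycle C D = ∃[ r ] ∀ i → at C (i ℕ.+ r) ≡ at D i

  HasCycleCount : ℕ → Set
  HasCycleCount c = Σ[ C ∈ (Fin c → Cycle) ]
    (∀ i j → SameCycle (C i) (C j) → i ≡ j) ×
    (∀ D → ∃[ i ] SameCycle (C i) D)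

-- The index 1 ≤ i ≤ k represented by an element of Fin k.
index : ∀ {k} → Fin k → ℕ
index i = suc (toℕ i)

v : ∀ {k} → ℂ → ℕ → Vector ℂ k
v ξ ℓ j = ξ ^ (index j ℕ.* ℓ)

H : (n : ℤ) (k : ℕ) .{{_ : NonZero k}} → ℂ → Matrix k k
H n k ξ i j = v ξ (ℓ %ℕ suc k) j -ℂ v ξ (ℓ %ℕ k) j
  where
  ℓ : ℤ
  ℓ = n ℤ.+ + k ℤ.+ + index i ℤ.- + 1

G : (n : ℤ) (k : ℕ) .{{_ : NonZero k}} → Rel (Fin (suc k)) 0ℓ
G n k a b = Σ[ i ∈ Fin k ]
  toℕ a ≡ (+ index i ℤ.+ n ℤ.- + 2) %ℕ suc k ×
  toℕ b ≡ (+ index i ℤ.+ n ℤ.- + 1) %ℕ k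

{-# OPTIONS --safe #-}

-- A vector x encodes the function f(ℓ) = Σⱼ xⱼ ξ^(jℓ) on the vertices 0, …, k, and x is in the kernel
-- of H iff f is constant along the edges of G(n,k). By Fourier inversion the functions obtained in this
-- way represent each class of functions modulo constants exactly once. In G(n,k) every vertex has at
-- most one incoming edge, and all but one (the sink) exactly one outgoing edge, so G(n,k) is a path
-- ending in the sink together with disjoint cycles. Modulo constants, the functions constant on
-- components therefore have as a basis the indicators of the cycles.

module Submission where

open import Algebra.Bundles using (CommutativeRing; RawRing)
open import Algebra.Structures using (IsCommutativeRing)
open import Data.Fin.Base using (Fin; zero; suc; toℕ; fromℕ<; punchOut)
open import Data.Fin.Properties using (any?; pigeonhole; injective⇒≤; punchOut-injective; toℕ<n; toℕ-injective; toℕ-fromℕ<; 0≢1+n; _≟_)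
open import Data.Integer.Base as ℤ using (ℤ; +_; _%ℕ_; _/ℕ_)
open import Data.Integer.DivMod using (a≡a%ℕn+[a/ℕn]*n; n%ℕd<d)
import Data.Integer.Properties as ℤ
open import Data.Integer.Solver renaming (module +-*-Solver to ℤ-Solver)
open import Data.Nat.Base as ℕ using (ℕ; zero; suc; NonZero)
open import Data.Nat.Divisibility using (>⇒∤; divides)
open import Data.Nat.DivMod using (_%_; _/_; _mod_; m≡m%n+[m/n]*n; m%n<n; n%n≡0; m<n⇒m%n≡m)
open import Data.Nat.GeneralisedArithmetic using (fold; fold-+)
open import Data.Nat.Induction using (<-rec)
import Data.Nat.Properties as ℕ
open import Data.Nat.Solver renaming (module +-*-Solver to ℕ-Solver)
open import Data.Product.Base using (∃; ∃-syntax; _,_; proj₁; proj₂)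
open import Data.Rational.Base as ℚ using (ℚ; 0ℚ; 1ℚ; ½; ∣_∣; _<_; _≤_; positive; nonNegative)
import Data.Rational.Properties as ℚ
open import Data.Rational.Solver renaming (module +-*-Solver to ℚ-Solver)
open import Data.Sum.Base using (_⊎_; inj₁; inj₂)
open import Data.Vec.Functional using (Vector; _∷_; replicate)
open import Function.Base using (_∘_)
open import Function.Definitions using (Injective)
open import Level using (0ℓ)
import Relation.Binary.Construct.On as On
open import Relation.Binary.Core using (Rel)
open import Relation.Binary.Definitions using (tri<; tri≈; tri>)
import Relation.Binary.PropositionalEquality as ≡
open import Relation.Binary.Structures using (IsEquivalence)
open import Relation.Nullary using (¬_; Dec; yes; no; contradiction)
open import Relation.Nullary.Decidable using (map′)
open import Relation.Unary using (Decidable)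
open ≡ using (_≡_; _≢_)

-- Discrete Fourier transform

-- The exponents in `v` run from 1 to k, so of the k+1 characters of the cyclic group of order k+1
-- only the trivial one is missing; this is where "modulo constants" comes from. The sources of the
-- edges are k consecutive integers reduced modulo k+1, the targets k consecutive integers reduced
-- modulo k, so both are pairwise distinct, and the sink is the one leftover residue, that of n - 2.
-- The obstacle is that equality in `ℂ` is undecidable and a nonzero number does not come with an
-- inverse, so the kernel cannot be found by elimination. The basis and the coefficients are instead
-- written down explicitly by the inverse transform, which divides only by the rational number k+1.
-- Primitivity of ξ enters through cancellation of the nonzero factor ξ^(a-b) - 1.

module Fourier (R : CommutativeRing 0ℓ 0ℓ) where

  open CommutativeRing R hiding (zero)
  open import Algebra.Properties.Ring ring using (-1*x≈-x; -‿distribʳ-*; x∙y⁻¹≈ε⇒x≈y; x≈y⇒x∙y⁻¹≈ε)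
  open import Algebra.Properties.Semiring.Exp semiring using (_^_; ^-homo-*; ^-assocʳ; ^-congˡ)
  open import Algebra.Properties.Semiring.Mult semiring using (_×_)
  open import Algebra.Properties.Semiring.Sum semiring
  open import Relation.Binary.Reasoning.Setoid setoid

  sum-cong : ∀ {n} {f g : Vector Carrier n} → (∀ i → f i ≈ g i) → sum f ≈ sum g
  sum-cong = sum-cong-≋

  δ : ∀ {n} → Fin n → Fin n → Carrier
  δ zero    zero    = 1#
  δ zero    (suc _) = 0#
  δ (suc _) zero    = 0#
  δ (suc i) (suc j) = δ i j

  δ-refl : ∀ {n} (i : Fin n) → δ i i ≡ 1#
  δ-refl zero    = ≡.refl
  δ-refl (suc i) = δ-refl i

  δ-≢ : ∀ {n} {i j : Fin n} → i ≢ j → δ i j ≡ 0#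
  δ-≢ {i = zero}  {zero}  i≢j = contradiction ≡.refl i≢j
  δ-≢ {i = zero}  {suc _} i≢j = ≡.refl
  δ-≢ {i = suc _} {zero}  i≢j = ≡.refl
  δ-≢ {i = suc i} {suc j} i≢j = δ-≢ (i≢j ∘ ≡.cong suc)

  δ-sym : ∀ {n} (i j : Fin n) → δ i j ≡ δ j i
  δ-sym zero    zero    = ≡.refl
  δ-sym zero    (suc j) = ≡.refl
  δ-sym (suc i) zero    = ≡.refl
  δ-sym (suc i) (suc j) = δ-sym i j

  sum-zero : ∀ {n} {f : Vector Carrier n} → (∀ i → f i ≈ 0#) → sum f ≈ 0#
  sum-zero {n} f≈0 = trans (sum-cong f≈0) (sum-replicate-zero n)

  sum-δ : ∀ {n} (g : Vector Carrier n) p → sum (λ i → g i * δ i p) ≈ g p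
  sum-δ g zero = begin
    g zero * 1# + sum (λ i → g (suc i) * 0#) ≈⟨ +-cong (*-identityʳ _) (sum-zero (λ i → zeroʳ (g (suc i)))) ⟩
    g zero + 0#                              ≈⟨ +-identityʳ _ ⟩
    g zero                                   ∎
  sum-δ g (suc p) = begin
    g zero * 0# + sum (λ i → g (suc i) * δ i p) ≈⟨ +-cong (zeroʳ _) (sum-δ (g ∘ suc) p) ⟩
    0# + g (suc p)                              ≈⟨ +-identityˡ _ ⟩
    g (suc p)                                   ∎

  apply : ∀ {m n} → (Fin m → Fin n → Carrier) → Vector Carrier m → Vector Carrier n
  apply A g j = sum (λ i → g i * A i j)

  apply-cong : ∀ {m n} (A : Fin m → Fin n → Carrier) {f g : Vector Carrier m} →
    (∀ i → f i ≈ g i) → ∀ j → apply A f j ≈ apply A g j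
  apply-cong A f≈g j = sum-cong (λ i → *-congʳ (f≈g i))

  apply-apply : ∀ {l m n} (A : Fin l → Fin m → Carrier) (B : Fin m → Fin n → Carrier) g p →
    apply B (apply A g) p ≈ apply (λ i → apply B (A i)) g p
  apply-apply A B g p = begin
    sum (λ j → sum (λ i → g i * A i j) * B j p)
      ≈⟨ sum-cong (λ j → *-distribʳ-sum (B j p) (λ i → g i * A i j)) ⟩
    sum (λ j → sum (λ i → g i * A i j * B j p))
      ≈⟨ ∑-comm (λ j i → g i * A i j * B j p) ⟩
    sum (λ i → sum (λ j → g i * A i j * B j p))
      ≈⟨ sum-cong (λ i → sum-cong (λ j → *-assoc (g i) (A i j) (B j p))) ⟩
    sum (λ i → sum (λ j → g i * (A i j * B j p)))
      ≈⟨ sum-cong (λ i → *-distribˡ-sum (g i) (λ j → A i j * B j p)) ⟨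
    sum (λ i → g i * sum (λ j → A i j * B j p)) ∎

  apply-inverse : ∀ {m n} (A : Fin m → Fin n → Carrier) (B : Fin n → Fin m → Carrier) →
    (∀ i p → apply B (A i) p ≈ δ i p) → ∀ g p → apply B (apply A g) p ≈ g p
  apply-inverse A B AB≈δ g p = begin
    apply B (apply A g) p             ≈⟨ apply-apply A B g p ⟩
    sum (λ i → g i * apply B (A i) p) ≈⟨ sum-cong (λ i → *-congˡ (AB≈δ i p)) ⟩
    sum (λ i → g i * δ i p)           ≈⟨ sum-δ g p ⟩
    g p                               ∎

  -- The undivided form holds in every commutative ring; for z different from 1 the factor z - 1 is
  -- later cancelled instead of inverted.
  geometric : ∀ z n → (z - 1#) * sum {n} (λ j → z ^ toℕ j) ≈ z ^ n - 1#
  geometric z zero    = trans (zeroʳ _) (sym (-‿inverseʳ 1#))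
  geometric z (suc n) = begin
    (z - 1#) * (1# + sum {n} (λ j → z * z ^ toℕ j))
      ≈⟨ distribˡ _ _ _ ⟩
    (z - 1#) * 1# + (z - 1#) * sum {n} (λ j → z * z ^ toℕ j)
      ≈⟨ +-cong (*-identityʳ _) (*-congˡ (sym (*-distribˡ-sum z (λ (j : Fin n) → z ^ toℕ j)))) ⟩
    (z - 1#) + (z - 1#) * (z * S)
      ≈⟨ +-congˡ (trans (sym (*-assoc _ _ _)) (trans (*-congʳ (*-comm _ _)) (*-assoc _ _ _))) ⟩
    (z - 1#) + z * ((z - 1#) * S)
      ≈⟨ +-congˡ (*-congˡ (geometric z n)) ⟩
    (z - 1#) + z * (z ^ n - 1#)
      ≈⟨ +-congˡ (trans (distribˡ z _ _) (+-congˡ (trans (*-comm z _) (-1*x≈-x z)))) ⟩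
    (z - 1#) + (z * z ^ n - z)
      ≈⟨ +-comm _ _ ⟩
    (z * z ^ n - z) + (z - 1#)
      ≈⟨ +-assoc _ _ _ ⟩
    z * z ^ n + (- z + (z - 1#))
      ≈⟨ +-congˡ (trans (sym (+-assoc _ _ _)) (trans (+-congʳ (-‿inverseˡ z)) (+-identityˡ _))) ⟩
    z * z ^ n - 1# ∎
    where S = sum {n} (λ j → z ^ toℕ j)

  1^n≈1 : ∀ n → 1# ^ n ≈ 1#
  1^n≈1 zero    = refl
  1^n≈1 (suc n) = trans (*-identityˡ _) (1^n≈1 n)

  -- `cancel-0` and `ι` replace the field axioms: a negated equality supports cancellation but
  -- yields no inverse, and 1/(k+1) is the only reciprocal that the inversion formula contains.
  module Transform
    (cancel-0 : ∀ z w → ¬ z ≈ 0# → z * w ≈ 0# → w ≈ 0#)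
    (k : ℕ) (ξ : Carrier) (ξ^[1+k]≈1 : ξ ^ suc k ≈ 1#)
    (ξ^j≉1 : ∀ j → 0 ℕ.< j → j ℕ.< suc k → ¬ ξ ^ j ≈ 1#)
    (ι : Carrier) (ι-inverse : (suc k × 1#) * ι ≈ 1#)
    where

    private
      V : Set
      V = Fin (suc k)

    ξ^[1+k]*n≈1 : ∀ n → ξ ^ (suc k ℕ.* n) ≈ 1#
    ξ^[1+k]*n≈1 n = begin
      ξ ^ (suc k ℕ.* n) ≈⟨ ^-assocʳ ξ (suc k) n ⟨
      (ξ ^ suc k) ^ n   ≈⟨ ^-congˡ n ξ^[1+k]≈1 ⟩
      1# ^ n            ≈⟨ 1^n≈1 n ⟩
      1#                ∎

    -- ξ ^ (k b) plays the role of ξ ^ (- b).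
    root : V → V → Carrier
    root a b = ξ ^ (toℕ a ℕ.+ k ℕ.* toℕ b)

    root-refl : ∀ a → root a a ≈ 1#
    root-refl a = ξ^[1+k]*n≈1 (toℕ a)

    -- `root a b` is ξ^(a-b). Since a and b are at most k, their distance `suc d` lies strictly
    -- between 0 and k+1, and ξ^(suc d) = 1 would contradict primitivity. The two unequal cases
    -- differ in whether ξ^(suc d) is `root a b` or its inverse.
    root-≢ : ∀ {a b} → a ≢ b → ¬ root a b ≈ 1#
    root-≢ {a} {b} a≢b e with ℕ.<-cmp (toℕ a) (toℕ b)
    ... | tri≈ _ a≡b _ = a≢b (toℕ-injective a≡b)
    ... | tri> _ _ b<a with d , p ← ℕ.m≤n⇒∃[o]m+o≡n b<a =
      ξ^j≉1 (suc d) ℕ.z<s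
        (ℕ.≤-<-trans (≡.subst (suc d ℕ.≤_) p (ℕ.s≤s (ℕ.m≤n+m d (toℕ b)))) (toℕ<n a)) (begin
        ξ ^ suc d                                 ≈⟨ *-identityʳ _ ⟨
        ξ ^ suc d * 1#                            ≈⟨ *-congˡ (ξ^[1+k]*n≈1 (toℕ b)) ⟨
        ξ ^ suc d * ξ ^ (suc k ℕ.* toℕ b)         ≈⟨ ^-homo-* ξ (suc d) (suc k ℕ.* toℕ b) ⟨
        ξ ^ (suc d ℕ.+ (toℕ b ℕ.+ k ℕ.* toℕ b))   ≡⟨ ≡.cong (ξ ^_) (≡.trans
            (≡.sym (ℕ.+-assoc (suc d) (toℕ b) (k ℕ.* toℕ b)))
            (≡.cong (ℕ._+ k ℕ.* toℕ b) (≡.trans (≡.cong suc (ℕ.+-comm d (toℕ b))) p))) ⟩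
        root a b                                  ≈⟨ e ⟩
        1#                                        ∎)
    ... | tri< a<b _ _ with d , p ← ℕ.m≤n⇒∃[o]m+o≡n a<b =
      ξ^j≉1 (suc d) ℕ.z<s
        (ℕ.≤-<-trans (≡.subst (suc d ℕ.≤_) p (ℕ.s≤s (ℕ.m≤n+m d (toℕ a)))) (toℕ<n b)) (begin
        ξ ^ suc d                                 ≈⟨ *-identityʳ _ ⟨
        ξ ^ suc d * 1#                            ≈⟨ *-congˡ e ⟨
        ξ ^ suc d * root a b                      ≈⟨ ^-homo-* ξ (suc d) _ ⟨
        ξ ^ (suc d ℕ.+ (toℕ a ℕ.+ k ℕ.* toℕ b))   ≡⟨ ≡.cong (ξ ^_) (≡.trans
            (≡.sym (ℕ.+-assoc (suc d) (toℕ a) (k ℕ.* toℕ b)))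
            (≡.cong (ℕ._+ k ℕ.* toℕ b) (≡.trans (≡.cong suc (ℕ.+-comm d (toℕ a))) p))) ⟩
        ξ ^ (suc k ℕ.* toℕ b)                     ≈⟨ ξ^[1+k]*n≈1 (toℕ b) ⟩
        1#                                        ∎)

    -- Orthogonality of characters: on the diagonal all k+1 terms are 1, and off it the geometric
    -- sum is annihilated by `root a b - 1#`, which is not zero.
    sum-root : ∀ a b → sum {suc k} (λ j → root a b ^ toℕ j) * ι ≈ δ a b
    sum-root a b with a ≟ b
    ... | yes ≡.refl = begin
      sum {suc k} (λ j → root a a ^ toℕ j) * ι
        ≈⟨ *-congʳ (sum-cong {suc k} (λ j → trans (^-congˡ (toℕ j) (root-refl a)) (1^n≈1 (toℕ j)))) ⟩
      sum (replicate (suc k) 1#) * ι  ≈⟨ *-congʳ (sum-replicate (suc k)) ⟩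
      (suc k × 1#) * ι                ≈⟨ ι-inverse ⟩
      1#                              ≡⟨ δ-refl a ⟨
      δ a a                           ∎
    ... | no a≢b = begin
      sum {suc k} (λ j → root a b ^ toℕ j) * ι ≈⟨ *-congʳ (cancel-0 (root a b - 1#) _
          (root-≢ a≢b ∘ x∙y⁻¹≈ε⇒x≈y (root a b) 1#)
          (trans (geometric (root a b) (suc k)) (x≈y⇒x∙y⁻¹≈ε root^[1+k]≈1))) ⟩
      0# * ι  ≈⟨ zeroˡ ι ⟩
      0#      ≡⟨ δ-≢ a≢b ⟨
      δ a b   ∎
      where
      root^[1+k]≈1 : root a b ^ suc k ≈ 1#
      root^[1+k]≈1 = begin
        root a b ^ suc k ≈⟨ ^-assocʳ ξ (toℕ a ℕ.+ k ℕ.* toℕ b) (suc k) ⟩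
        ξ ^ ((toℕ a ℕ.+ k ℕ.* toℕ b) ℕ.* suc k) ≡⟨ ≡.cong (ξ ^_) (ℕ.*-comm (toℕ a ℕ.+ k ℕ.* toℕ b) (suc k)) ⟩
        ξ ^ (suc k ℕ.* (toℕ a ℕ.+ k ℕ.* toℕ b)) ≈⟨ ξ^[1+k]*n≈1 (toℕ a ℕ.+ k ℕ.* toℕ b) ⟩
        1# ∎

    -- The Fourier matrix and its inverse: `χ̄` consists of the inverse characters divided by k+1.
    χ χ̄ : V → V → Carrier
    χ a b = ξ ^ (toℕ a ℕ.* toℕ b)
    χ̄ a b = ξ ^ (k ℕ.* (toℕ a ℕ.* toℕ b)) * ι

    χ-sym : ∀ a b → χ a b ≡ χ b a
    χ-sym a b = ≡.cong (ξ ^_) (ℕ.*-comm (toℕ a) (toℕ b))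

    χ̄-sym : ∀ a b → χ̄ a b ≡ χ̄ b a
    χ̄-sym a b = ≡.cong (λ e → ξ ^ (k ℕ.* e) * ι) (ℕ.*-comm (toℕ a) (toℕ b))

    χ-χ̄ : ∀ a b → apply χ̄ (χ a) b ≈ δ a b
    χ-χ̄ a b = begin
      sum {suc k} (λ j → χ a j * χ̄ j b)       ≈⟨ sum-cong {suc k} (λ j →
        sym (*-assoc (χ a j) (ξ ^ (k ℕ.* (toℕ j ℕ.* toℕ b))) ι)) ⟩
      sum {suc k} (λ j → χ a j * ξ ^ (k ℕ.* (toℕ j ℕ.* toℕ b)) * ι)
        ≈⟨ *-distribʳ-sum ι (λ (j : V) → χ a j * ξ ^ (k ℕ.* (toℕ j ℕ.* toℕ b))) ⟨
      sum {suc k} (λ j → χ a j * ξ ^ (k ℕ.* (toℕ j ℕ.* toℕ b))) * ι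
        ≈⟨ *-congʳ (sum-cong {suc k} power) ⟩
      sum {suc k} (λ j → root a b ^ toℕ j) * ι ≈⟨ sum-root a b ⟩
      δ a b                                    ∎
      where
      open ℕ-Solver using (solve; _:=_; _:+_; _:*_)
      power : ∀ (j : V) → χ a j * ξ ^ (k ℕ.* (toℕ j ℕ.* toℕ b)) ≈ root a b ^ toℕ j
      power j = begin
        χ a j * ξ ^ (k ℕ.* (toℕ j ℕ.* toℕ b))               ≈⟨ ^-homo-* ξ (toℕ a ℕ.* toℕ j) _ ⟨
        ξ ^ (toℕ a ℕ.* toℕ j ℕ.+ k ℕ.* (toℕ j ℕ.* toℕ b))   ≡⟨ ≡.cong (ξ ^_) (solve 4
            (λ a j k b → a :* j :+ k :* (j :* b) := (a :+ k :* b) :* j) ≡.refl (toℕ a) (toℕ j) k (toℕ b)) ⟩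
        ξ ^ ((toℕ a ℕ.+ k ℕ.* toℕ b) ℕ.* toℕ j)             ≈⟨ ^-assocʳ ξ (toℕ a ℕ.+ k ℕ.* toℕ b) (toℕ j) ⟨
        root a b ^ toℕ j                                    ∎

    -- Both matrices are symmetric, so this is `χ-χ̄` with a and b exchanged.
    χ̄-χ : ∀ a b → apply χ (χ̄ a) b ≈ δ b a
    χ̄-χ a b = begin
      sum {suc k} (λ j → χ̄ a j * χ j b) ≈⟨ sum-cong {suc k} (λ j →
        trans (*-comm _ _) (*-cong (reflexive (χ-sym j b)) (reflexive (χ̄-sym a j)))) ⟩
      sum {suc k} (λ j → χ b j * χ̄ j a) ≈⟨ χ-χ̄ b a ⟩
      δ b a                              ∎

    inverseˡ : ∀ g p → apply χ̄ (apply χ g) p ≈ g p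
    inverseˡ = apply-inverse χ χ̄ χ-χ̄

    inverseʳ : ∀ g p → apply χ (apply χ̄ g) p ≈ g p
    inverseʳ = apply-inverse χ̄ χ (λ a b → trans (χ̄-χ a b) (reflexive (δ-sym b a)))

    values : Vector Carrier k → V → Carrier
    values x ℓ = sum (λ j → x j * χ (suc j) ℓ)

    -- Frequency zero has the constant character 1, so the full transform and `values` differ by a
    -- constant. Every argument modulo constants below rests on this.
    apply-χ-∷ : ∀ X ℓ → apply χ X ℓ ≈ X zero + values (X ∘ suc) ℓ
    apply-χ-∷ X ℓ = +-congʳ (*-identityʳ (X zero))

    values-difference : ∀ x p q →
      sum (λ j → (χ (suc j) p - χ (suc j) q) * x j) ≈ values x p - values x q
    values-difference x p q = begin
      sum (λ j → (χ (suc j) p - χ (suc j) q) * x j)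
        ≈⟨ sum-cong (λ j → trans (*-comm _ _) (trans (distribˡ (x j) _ _)
             (+-congˡ (sym (trans (-1*x≈-x _) (-‿distribʳ-* (x j) _)))))) ⟩
      sum (λ j → x j * χ (suc j) p + - 1# * (x j * χ (suc j) q))
        ≈⟨ ∑-distrib-+ (λ j → x j * χ (suc j) p) (λ j → - 1# * (x j * χ (suc j) q)) ⟩
      values x p + sum (λ j → - 1# * (x j * χ (suc j) q))
        ≈⟨ +-congˡ (*-distribˡ-sum (- 1#) (λ j → x j * χ (suc j) q)) ⟨
      values x p + - 1# * values x q
        ≈⟨ +-congˡ (-1*x≈-x (values x q)) ⟩
      values x p - values x q ∎

    module _ (r : Vector Carrier k) (p q : V) (r≡ : ∀ j → r j ≡ χ (suc j) p - χ (suc j) q) where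

      row-values : ∀ x → sum (λ j → r j * x j) ≈ values x p - values x q
      row-values x = trans (sum-cong (λ j → *-congʳ (reflexive (r≡ j)))) (values-difference x p q)

      values-≈⇒row-≈0 : ∀ x → values x p ≈ values x q → sum (λ j → r j * x j) ≈ 0#
      values-≈⇒row-≈0 x e = trans (row-values x) (x≈y⇒x∙y⁻¹≈ε e)

      row-≈0⇒values-≈ : ∀ x → sum (λ j → r j * x j) ≈ 0# → values x p ≈ values x q
      row-≈0⇒values-≈ x e = x∙y⁻¹≈ε⇒x≈y _ _ (trans (sym (row-values x)) e)

    module Basis {c : ℕ} (comp : V → Fin (suc c)) (rep : Fin (suc c) → V)
             (comp-rep : ∀ i → comp (rep i) ≡ i) where

      -- The zeroth Fourier coefficient is dropped, so basis i represents an indicator up to a constant.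
      basis : Fin c → Vector Carrier k
      basis i j = apply χ̄ (λ ℓ → δ (suc i) (comp ℓ)) (suc j)

      -- Vanishing on the component of the sink is the normalisation that selects one function from
      -- each class modulo constants.
      extend : Vector Carrier c → V → Carrier
      extend a ℓ = (0# ∷ a) (comp ℓ)

      lincomb-basis : ∀ (a : Vector Carrier c) j →
        sum (λ i → a i * basis i j) ≈ apply χ̄ (extend a) (suc j)
      lincomb-basis a j = begin
        sum (λ i → a i * basis i j) ≈⟨ apply-apply (λ i ℓ → δ (suc i) (comp ℓ)) χ̄ a (suc j) ⟨
        apply χ̄ (apply (λ i ℓ → δ (suc i) (comp ℓ)) a) (suc j) ≈⟨ apply-cong χ̄ extend-δ (suc j) ⟩
        apply χ̄ (extend a) (suc j) ∎
        where
        extend-δ : ∀ ℓ → sum (λ i → a i * δ (suc i) (comp ℓ)) ≈ extend a ℓ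
        extend-δ ℓ = begin
          sum (λ i → a i * δ (suc i) (comp ℓ))         ≈⟨ +-identityˡ _ ⟨
          -- A zero term for the component of the sink is inserted, so that the sum runs over all
          -- components and `sum-δ` applies.
          0# + sum (λ i → a i * δ (suc i) (comp ℓ))    ≈⟨ +-congʳ (zeroˡ _) ⟨
          sum (λ i → (0# ∷ a) i * δ i (comp ℓ))        ≈⟨ sum-δ (0# ∷ a) (comp ℓ) ⟩
          extend a ℓ                                   ∎

      -- By inversion, `values (basis i)` is the indicator of component `suc i` minus its dropped
      -- coefficient `ĝ zero`, a constant.
      basis-values : ∀ i {p q} → comp p ≡ comp q → values (basis i) p ≈ values (basis i) q
      basis-values i {p} {q} e = begin
        values (basis i) p                     ≈⟨ shift p ⟩
        - ĝ zero + δ (suc i) (comp p)          ≡⟨ ≡.cong (λ r → - ĝ zero + δ (suc i) r) e ⟩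
        - ĝ zero + δ (suc i) (comp q)          ≈⟨ shift q ⟨
        values (basis i) q                     ∎
        where
        ĝ : Vector Carrier (suc k)
        ĝ = apply χ̄ (λ ℓ → δ (suc i) (comp ℓ))
        shift : ∀ p → values (basis i) p ≈ - ĝ zero + δ (suc i) (comp p)
        shift p = begin
          values (basis i) p                            ≈⟨ +-identityˡ _ ⟨
          0# + values (basis i) p                       ≈⟨ +-congʳ (-‿inverseˡ (ĝ zero)) ⟨
          - ĝ zero + ĝ zero + values (basis i) p        ≈⟨ +-assoc _ _ _ ⟩
          - ĝ zero + (ĝ zero + values (basis i) p)      ≈⟨ +-congˡ (apply-χ-∷ ĝ p) ⟨
          - ĝ zero + apply χ ĝ p                        ≈⟨ +-congˡ (inverseʳ (λ ℓ → δ (suc i) (comp ℓ)) p) ⟩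
          - ĝ zero + δ (suc i) (comp p)                 ∎

      -- If all coefficients at nonzero frequencies vanish, then `extend a` is constant; its value
      -- on the component of the sink is 0.
      basis-independent : ∀ a → (∀ j → sum (λ i → a i * basis i j) ≈ 0#) → ∀ i → a i ≈ 0#
      basis-independent a a≈0 i = begin
        a i                     ≡⟨ ≡.cong (0# ∷ a) (comp-rep (suc i)) ⟨
        extend a (rep (suc i))  ≈⟨ constant (rep (suc i)) ⟩
        ĝ zero                  ≈⟨ constant (rep zero) ⟨
        extend a (rep zero)     ≡⟨ ≡.cong (0# ∷ a) (comp-rep zero) ⟩
        0#                      ∎
        where
        ĝ : Vector Carrier (suc k)
        ĝ = apply χ̄ (extend a)
        constant : ∀ p → extend a p ≈ ĝ zero
        constant p = begin
          extend a p                      ≈⟨ inverseʳ (extend a) p ⟨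
          apply χ ĝ p                     ≈⟨ apply-χ-∷ ĝ p ⟩
          ĝ zero + values (ĝ ∘ suc) p     ≈⟨ +-congˡ (sum-zero (λ j →
            trans (*-congʳ (trans (sym (lincomb-basis a j)) (a≈0 j))) (zeroˡ _))) ⟩
          ĝ zero + 0#                     ≈⟨ +-identityʳ _ ⟩
          ĝ zero                          ∎

      basis-spanning : ∀ x → (∀ p → values x p ≈ values x (rep (comp p))) →
        ∃[ a ] ∀ j → x j ≈ sum (λ i → a i * basis i j)
      basis-spanning x invariant = a , λ j → begin
        x j                             ≈⟨ inverseˡ X (suc j) ⟨
        apply χ̄ (apply χ X) (suc j)     ≈⟨ apply-cong χ̄ shifted (suc j) ⟩
        apply χ̄ (extend a) (suc j)      ≈⟨ lincomb-basis a j ⟨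
        sum (λ i → a i * basis i j)     ∎
        where
        X : Vector Carrier (suc k)
        -- The free coefficient at frequency zero is chosen to make the function vanish at the
        -- sink's representative, which turns it into some `extend a`.
        X = (- values x (rep zero)) ∷ x
        a : Vector Carrier c
        a i = - values x (rep zero) + values x (rep (suc i))
        at-rep : ∀ r → - values x (rep zero) + values x (rep r) ≈ (0# ∷ a) r
        at-rep zero    = -‿inverseˡ _
        at-rep (suc i) = refl
        shifted : ∀ p → apply χ X p ≈ extend a p
        shifted p = begin
          apply χ X p                                          ≈⟨ apply-χ-∷ X p ⟩
          - values x (rep zero) + values x p                   ≈⟨ +-congˡ (invariant p) ⟩
          - values x (rep zero) + values x (rep (comp p))      ≈⟨ at-rep (comp p) ⟩
          extend a p                                           ∎

open import Defs
open import Algebra.Definitions.RawSemiring (RawRing.rawSemiring ℂ-rawRing) using () renaming (_×_ to _×ℂ_)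
open import Data.Product.Base using (_×_)
open ≡ using (refl; sym; trans; cong; cong₂; subst; subst₂; module ≡-Reasoning)

-- Iterates of a self-map, and systems of representatives

least : ∀ {P : ℕ → Set} → Decidable P → ∃ P → ∃[ n ] P n × (∀ m → m ℕ.< n → ¬ P m)
least {P} P? (n , pn) = <-rec (λ n → P n → ∃[ n ] P n × (∀ m → m ℕ.< n → ¬ P m)) step n pn
  where
  step : ∀ n → (∀ {m} → m ℕ.< n → P m → ∃[ n ] P n × (∀ m → m ℕ.< n → ¬ P m)) →
         P n → ∃[ n ] P n × (∀ m → m ℕ.< n → ¬ P m)
  step n rec pn with ℕ.anyUpTo? P? n
  ... | yes (m , m<n , pm) = rec m<n pm
  ... | no none            = n , pn , λ m m<n pm → none (m , m<n , pm)

record Representatives {n} (P : Fin n → Set) (_∼_ : Rel (Fin n) 0ℓ) : Set where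
  field
    count    : ℕ
    rep      : Fin count → Fin n
    rep-P    : ∀ i → P (rep i)
    distinct : ∀ i j → rep i ∼ rep j → i ≡ j
    complete : ∀ v → P v → ∃[ i ] rep i ∼ v

-- Representatives of the tail are found first, and `zero` is added when it satisfies `P` and none
-- of them is related to it. Symmetry and decidability are asked for on `P` only, because
-- reachability is symmetric on cycles but not on the path to the sink.
representatives : ∀ {n} {P : Fin n → Set} {_∼_ : Rel (Fin n) 0ℓ} → Decidable P →
  (∀ {v} → P v → v ∼ v) → (∀ {v w} → P v → v ∼ w → w ∼ v) → (∀ {v} w → P v → Dec (v ∼ w)) →
  Representatives P _∼_
representatives {zero} P? ∼-refl ∼-sym ∼? = record
  { count = 0 ; rep = λ () ; rep-P = λ () ; distinct = λ () ; complete = λ () }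
representatives {suc n} {P} {_∼_} P? ∼-refl ∼-sym ∼?
  with representatives {P = P ∘ suc} {_∼_ = λ v w → suc v ∼ suc w} (P? ∘ suc) ∼-refl ∼-sym (∼? ∘ suc)
     | P? zero
... | R | no ¬p0 = record
  { count = count ; rep = suc ∘ rep ; rep-P = rep-P ; distinct = distinct
  ; complete = λ { zero p → contradiction p ¬p0 ; (suc v) p → complete v p } }
  where open Representatives R
... | R | yes p0 with any? (λ i → ∼? zero (Representatives.rep-P R i))
...   | yes 0-found = record
  { count = count ; rep = suc ∘ rep ; rep-P = rep-P ; distinct = distinct
  ; complete = λ { zero _ → 0-found ; (suc v) p → complete v p } }
  where open Representatives R
...   | no 0-new = record
  { count = suc count
  ; rep = λ { zero → zero ; (suc i) → suc (rep i) }
  ; rep-P = λ { zero → p0 ; (suc i) → rep-P i }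
  ; distinct = λ
    { zero    zero    _ → refl
    ; zero    (suc j) e → contradiction (j , ∼-sym p0 e) 0-new
    ; (suc i) zero    e → contradiction (i , e) 0-new
    ; (suc i) (suc j) e → cong suc (distinct i j e) }
  ; complete = λ
    { zero    _ → zero , ∼-refl p0
    ; (suc v) p → let i , e = complete v p in suc i , e } }
  where open Representatives R

module _ {A : Set} (s : A → A) where

  fold-period-* : ∀ {v r} → fold v s r ≡ v → ∀ q → fold v s (q ℕ.* r) ≡ v
  fold-period-* e zero = refl
  fold-period-* {v} {r} e (suc q) =
    trans (fold-+ v s r) (trans (cong (λ w → fold w s r) (fold-period-* e q)) e)

  fold-period-% : ∀ {v r} .{{_ : NonZero r}} → fold v s r ≡ v → ∀ t → fold v s (t % r) ≡ fold v s t
  fold-period-% {v} {r} e t = sym (begin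
    fold v s t                               ≡⟨ cong (fold v s) (m≡m%n+[m/n]*n t r) ⟩
    fold v s (t % r ℕ.+ (t / r) ℕ.* r)       ≡⟨ fold-+ v s (t % r) ⟩
    fold (fold v s ((t / r) ℕ.* r)) s (t % r) ≡⟨ cong (λ w → fold w s (t % r)) (fold-period-* e (t / r)) ⟩
    fold v s (t % r)                         ∎)
    where open ≡-Reasoning

  fold-fixed : ∀ {v} → s v ≡ v → ∀ t → fold v s t ≡ v
  fold-fixed e zero    = refl
  fold-fixed e (suc t) = trans (cong s (fold-fixed e t)) e

  -- Together with the t steps already made, t * r further steps give t * (r + 1), a multiple of the
  -- period.
  fold-return : ∀ {v w r} → fold v s (suc r) ≡ v → ∀ t → fold v s t ≡ w → fold w s (t ℕ.* r) ≡ v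
  fold-return {v} {w} {r} per t refl = begin
    fold (fold v s t) s (t ℕ.* r) ≡⟨ fold-+ v s (t ℕ.* r) ⟨
    fold v s (t ℕ.* r ℕ.+ t)      ≡⟨ cong (fold v s) (trans (ℕ.+-comm (t ℕ.* r) t) (sym (ℕ.*-suc t r))) ⟩
    fold v s (t ℕ.* suc r)        ≡⟨ fold-period-* per t ⟩
    v                             ∎
    where open ≡-Reasoning

-- Components and cycles of a partial injection

-- The successor map is made total by fixing the sink.
record IsSuccessor {V : Set} (_⟶_ : Rel V 0ℓ) (sink : V) (s : V → V) : Set where
  field
    s-sink  : s sink ≡ sink
    ¬sink⟶  : ∀ {b} → ¬ sink ⟶ b
    ⟶⇒s     : ∀ {a b} → a ⟶ b → s a ≡ b
    s⇒⟶     : ∀ {a} → a ≢ sink → a ⟶ s a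
    s-inj   : ∀ {a b} → a ≢ sink → b ≢ sink → s a ≡ s b → a ≡ b

-- Component zero is that of the sink; the others are the cycles.
record Components {V : Set} (_⟶_ : Rel V 0ℓ) : Set₁ where
  field
    count      : ℕ
    cycleCount : HasCycleCount _⟶_ count
    comp       : V → Fin (suc count)
    rep        : Fin (suc count) → V
    comp-rep   : ∀ i → comp (rep i) ≡ i
    comp-edge  : ∀ {a b} → a ⟶ b → comp a ≡ comp b
    to-rep     : ∀ {_≈_ : Rel V 0ℓ} → IsEquivalence _≈_ → (∀ {a b} → a ⟶ b → a ≈ b) →
                 ∀ v → v ≈ rep (comp v)

module _ {N : ℕ} {_⟶_ : Rel (Fin N) 0ℓ} {sink : Fin N} {s : Fin N → Fin N}
         (isSuccessor : IsSuccessor _⟶_ sink s) where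

  open IsSuccessor isSuccessor

  private
    V : Set
    V = Fin N

    Reaches : V → V → Set
    Reaches v w = ∃[ t ] fold v s t ≡ w

    OnCycle : V → Set
    OnCycle v = v ≢ sink × ∃[ r ] fold v s (suc r) ≡ v

    -- The map `s` is injective only away from the sink, so its last application can be stripped
    -- from both sides as long as the orbit has not met the sink.
    cancel : ∀ v i d → (∀ t → t ℕ.< i ℕ.+ d → fold v s t ≢ sink) →
             fold v s i ≡ fold v s (i ℕ.+ d) → v ≡ fold v s d
    cancel v zero    d avoid e = e
    cancel v (suc i) d avoid e = cancel v i d (λ t t< → avoid t (ℕ.m<n⇒m<1+n t<))
      (s-inj (avoid i (ℕ.s≤s (ℕ.m≤m+n i d))) (avoid (i ℕ.+ d) ℕ.≤-refl) e)

    -- Among N+1 iterates two coincide, at times i < j. If the sink does not occur before time j,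
    -- the first i steps cancel and v itself recurs after j - i = `suc d` steps.
    dichotomy : ∀ v → Reaches v sink ⊎ OnCycle v
    dichotomy v with pigeonhole (ℕ.n<1+n N) (λ i → fold v s (toℕ i))
    ... | i , j , i<j , e with ℕ.m≤n⇒∃[o]m+o≡n i<j | ℕ.anyUpTo? (λ t → fold v s t ≟ sink) (toℕ j)
    ...   | _     | yes (t , _ , e′) = inj₁ (t , e′)
    ...   | d , q | no avoid = inj₂
      ( (λ v≡sink → avoid (0 , ℕ.≤-<-trans ℕ.z≤n i<j , v≡sink))
      , d , sym (cancel v (toℕ i) (suc d)
              (λ t t< e′ → avoid (t , subst (t ℕ.<_) q′ t< , e′))
              (trans e (cong (fold v s) (sym q′)))) )
      where
      q′ : toℕ i ℕ.+ suc d ≡ toℕ j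
      q′ = trans (ℕ.+-suc (toℕ i) d) q

    -- A periodic orbit returns to v even after meeting the sink, but from the sink it can no longer
    -- move.
    exclusive : ∀ {v} → Reaches v sink → ¬ OnCycle v
    exclusive (t , e) (v≢sink , r , per) =
      v≢sink (trans (sym (fold-return s per t e)) (fold-fixed s s-sink (t ℕ.* r)))

    onCycle? : Decidable OnCycle
    onCycle? v with dichotomy v
    ... | inj₁ reaches = no (exclusive reaches)
    ... | inj₂ onCycle = yes onCycle

    -- The number of steps may be reduced modulo the period, so a search through one period
    -- suffices.
    reaches? : ∀ {v} w → OnCycle v → Dec (Reaches v w)
    reaches? {v} w (_ , r , per) = map′
      (λ (t , _ , e) → t , e)
      (λ (t , e) → t % suc r , m%n<n t (suc r) , trans (fold-period-% s per t) e)
      (ℕ.anyUpTo? (λ t → fold v s t ≟ w) (suc r))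

    reaches-sym : ∀ {v w} → OnCycle v → Reaches v w → Reaches w v
    reaches-sym (_ , r , per) (t , e) = t ℕ.* r , fold-return s per t e

    reaches-trans : ∀ {u v w} → Reaches u v → Reaches v w → Reaches u w
    reaches-trans {u} (t , refl) (t′ , e) = t′ ℕ.+ t , trans (fold-+ u s t′) e

    R : Representatives OnCycle Reaches
    R = representatives onCycle? (λ _ → 0 , refl) reaches-sym reaches?

    open Representatives R renaming (rep to rep₀)

    module _ {v} (onCycle : OnCycle v) where
      private
        Period : ℕ → Set
        Period r = fold v s (suc r) ≡ v

        -- The period supplied by `OnCycle` may wind around several times; only the least one gives
        -- distinct vertices.
        leastPeriod : ∃[ r ] Period r × (∀ m → m ℕ.< r → ¬ Period m)
        leastPeriod = least (λ r → fold v s (suc r) ≟ v) (proj₂ onCycle)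

        r = proj₁ leastPeriod
        per = proj₁ (proj₂ leastPeriod)
        minimal = proj₂ (proj₂ leastPeriod)

        vertex : Fin (suc r) → V
        vertex i = fold v s (toℕ i)

        at-fold : ∀ i → vertex (i mod suc r) ≡ fold v s i
        at-fold i = trans (cong (fold v s) (toℕ-fromℕ< (m%n<n i (suc r)))) (fold-period-% s per i)

        avoid : ∀ t → fold v s t ≢ sink
        avoid t e = exclusive (t , e) onCycle

        no-collision : ∀ i j → i ℕ.< j → j ℕ.< suc r → fold v s i ≢ fold v s j
        no-collision i j i<j j≤r e with ℕ.m≤n⇒∃[o]m+o≡n i<j
        ... | d , refl = minimal d (ℕ.≤-<-trans (ℕ.m≤n+m d i) (ℕ.s≤s⁻¹ j≤r))
          (sym (cancel v i (suc d) (λ t _ → avoid t) (trans e (cong (fold v s) (sym (ℕ.+-suc i d))))))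

        vertex-injective : Injective _≡_ _≡_ vertex
        vertex-injective {i} {j} e with ℕ.<-cmp (toℕ i) (toℕ j)
        ... | tri< i<j _ _ = contradiction e (no-collision (toℕ i) (toℕ j) i<j (toℕ<n j))
        ... | tri≈ _ i≡j _ = toℕ-injective i≡j
        ... | tri> _ _ j<i = contradiction (sym e) (no-collision (toℕ j) (toℕ i) j<i (toℕ<n i))

      orbit : Cycle _⟶_
      orbit = record
        { size     = suc r
        ; vertex   = vertex
        ; distinct = vertex-injective
        ; edge     = λ i → subst₂ _⟶_ (sym (at-fold i)) (sym (at-fold (suc i))) (s⇒⟶ (avoid i))
        }

      at-orbit : ∀ i → Cycle.at orbit i ≡ fold v s i
      at-orbit = at-fold

    module _ (D : Cycle _⟶_) where
      open Cycle D using (at; size; edge; vertex)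

      -- Every edge follows `s`, so a cycle is determined by its starting vertex.
      at≡fold : ∀ i → at i ≡ fold (at 0) s i
      at≡fold zero    = refl
      at≡fold (suc i) = trans (sym (⟶⇒s (edge i))) (cong s (at≡fold i))

      at0-onCycle : OnCycle (at 0)
      at0-onCycle = (λ e → ¬sink⟶ (subst (_⟶ at 1) e (edge 0))) , ℕ.pred size ,
        (begin
          fold (at 0) s (suc (ℕ.pred size)) ≡⟨ cong (fold (at 0) s) (ℕ.suc-pred size) ⟩
          fold (at 0) s size                ≡⟨ at≡fold size ⟨
          at size                           ≡⟨ cong vertex (toℕ-injective size-mod) ⟩
          at 0                              ∎)
        where
        open ≡-Reasoning
        size-mod : toℕ (size mod size) ≡ toℕ (0 mod size)
        size-mod = trans (toℕ-fromℕ< _) (trans (n%n≡0 size) (sym (trans (toℕ-fromℕ< _) (m<n⇒m%n≡m (ℕ.>-nonZero⁻¹ size)))))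

    cycles : Fin count → Cycle _⟶_
    cycles i = orbit (rep-P i)

    cycles-distinct : ∀ i j → SameCycle _⟶_ (cycles i) (cycles j) → i ≡ j
    cycles-distinct i j (r , same) =
      distinct i j (r , trans (sym (at-orbit (rep-P i) r)) (trans (same 0) (at-orbit (rep-P j) 0)))

    -- The rotation is the number of steps from the representative to the starting vertex of `D`;
    -- from there both cycles follow `s`.
    cycles-complete : ∀ D → ∃[ i ] SameCycle _⟶_ (cycles i) D
    cycles-complete D = let i , t , e = complete (Cycle.at D 0) (at0-onCycle D) in i , t , λ j → begin
      Cycle.at (cycles i) (j ℕ.+ t)  ≡⟨ at-orbit (rep-P i) (j ℕ.+ t) ⟩
      fold (rep₀ i) s (j ℕ.+ t)      ≡⟨ fold-+ (rep₀ i) s j ⟩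
      fold (fold (rep₀ i) s t) s j   ≡⟨ cong (λ w → fold w s j) e ⟩
      fold (Cycle.at D 0) s j        ≡⟨ at≡fold D j ⟨
      Cycle.at D j                   ∎
      where open ≡-Reasoning

    comp : V → Fin (suc count)
    comp v with dichotomy v
    ... | inj₁ _       = zero
    ... | inj₂ onCycle = suc (proj₁ (complete v onCycle))

    rep : Fin (suc count) → V
    rep zero    = sink
    rep (suc i) = rep₀ i

    comp-sink : ∀ {v} → Reaches v sink → comp v ≡ zero
    comp-sink {v} reaches with dichotomy v
    ... | inj₁ _       = refl
    ... | inj₂ onCycle = contradiction onCycle (exclusive reaches)

    comp-cycle : ∀ {v} i → Reaches (rep₀ i) v → comp v ≡ suc i
    comp-cycle {v} i reaches with dichotomy v
    ... | inj₁ v→sink  = contradiction (rep-P i) (exclusive (reaches-trans reaches v→sink))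
    ... | inj₂ onCycle = cong suc (distinct _ i
      (reaches-trans (proj₂ (complete v onCycle)) (reaches-sym (rep-P i) reaches)))

    comp-s : ∀ v → comp v ≡ comp (s v)
    comp-s v with dichotomy v
    ... | inj₁ (t , e) = sym (comp-sink (t , (begin
      fold (s v) s t      ≡⟨ fold-+ v s t ⟨
      fold v s (t ℕ.+ 1)  ≡⟨ cong (fold v s) (ℕ.+-comm t 1) ⟩
      s (fold v s t)      ≡⟨ cong s e ⟩
      s sink              ≡⟨ s-sink ⟩
      sink                ∎)))
      where open ≡-Reasoning
    ... | inj₂ onCycle =
      let i , t , e = complete v onCycle in sym (comp-cycle i (suc t , cong s e))

    module _ {_≈_ : Rel V 0ℓ} (≈-equiv : IsEquivalence _≈_) (⟶⇒≈ : ∀ {a b} → a ⟶ b → a ≈ b) where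
      private module E = IsEquivalence ≈-equiv

      v≈sv : ∀ v → v ≈ s v
      v≈sv v with v ≟ sink
      ... | yes refl    = subst (v ≈_) (sym s-sink) E.refl
      ... | no  v≢sink  = ⟶⇒≈ (s⇒⟶ v≢sink)

      v≈fold : ∀ v t → v ≈ fold v s t
      v≈fold v zero    = E.refl
      v≈fold v (suc t) = E.trans (v≈fold v t) (v≈sv _)

      -- On the path the walk leads from v forward to the sink; on a cycle it leads from the
      -- representative to v and is reversed by symmetry of `≈`.
      v≈rep : ∀ v → v ≈ rep (comp v)
      v≈rep v with dichotomy v
      ... | inj₁ (t , e) = subst (v ≈_) e (v≈fold v t)
      ... | inj₂ onCycle =
        let i , t , e = complete v onCycle in E.sym (subst (rep₀ i ≈_) e (v≈fold (rep₀ i) t))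

  components : Components _⟶_
  components = record
    { count      = count
    ; cycleCount = cycles , cycles-distinct , cycles-complete
    ; comp       = comp
    ; rep        = rep
    ; comp-rep   = λ { zero → comp-sink (0 , refl) ; (suc i) → comp-cycle i (0 , refl) }
    ; comp-edge  = λ {a} a⟶b → trans (comp-s a) (cong comp (⟶⇒s a⟶b))
    ; to-rep     = v≈rep
    }

-- The graph G(n,k)

multiple<⇒≡0 : ∀ {x q d} → x ≡ q ℤ.* + d → ℤ.∣ x ∣ ℕ.< d → x ≡ + 0
multiple<⇒≡0 {x} {q} {d} x≡qd ∣x∣<d with ℤ.∣ x ∣ in ∣x∣≡
... | zero  = ℤ.∣i∣≡0⇒i≡0 ∣x∣≡
... | suc m = contradiction
  (divides ℤ.∣ q ∣ (trans (sym ∣x∣≡) (trans (cong ℤ.∣_∣ x≡qd) (ℤ.abs-* q (+ d))))) (>⇒∤ ∣x∣<d)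

∣m-n∣<d : ∀ {m n d} → m ℕ.< d → n ℕ.< d → ℤ.∣ + m ℤ.- + n ∣ ℕ.< d
∣m-n∣<d {m} {n} {d} m<d n<d = ℕ.≤-<-trans
  (subst (λ z → ℤ.∣ z ∣ ℕ.≤ m ℕ.⊔ n) (sym (ℤ.[+m]-[+n]≡m⊖n m n)) (ℤ.∣m⊝n∣≤m⊔n m n))
  (ℕ.⊔-pres-<m m<d n<d)

%ℕ-difference : ∀ x y d .{{_ : NonZero d}} →
  x ℤ.- y ≡ (+ (x %ℕ d) ℤ.- + (y %ℕ d)) ℤ.+ (x /ℕ d ℤ.- y /ℕ d) ℤ.* + d
%ℕ-difference x y d = trans
  (cong₂ ℤ._-_ (a≡a%ℕn+[a/ℕn]*n x d) (a≡a%ℕn+[a/ℕn]*n y d))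
  (solve 5 (λ r q r′ q′ d → (r :+ q :* d) :- (r′ :+ q′ :* d) := (r :- r′) :+ (q :- q′) :* d) refl
    (+ (x %ℕ d)) (x /ℕ d) (+ (y %ℕ d)) (y /ℕ d) (+ d))
  where open ℤ-Solver using (solve; _:=_; _:+_; _:*_; _:-_)

-- The two remainders differ by a multiple of d, and both lie in [0, d).
%ℕ-+d : ∀ x d .{{_ : NonZero d}} → (x ℤ.+ + d) %ℕ d ≡ x %ℕ d
%ℕ-+d x d = ℤ.+-injective (ℤ.i-j≡0⇒i≡j _ _ (multiple<⇒≡0 {q = + 1 ℤ.- Q} (begin
    r              ≡⟨ solve 3 (λ r Q d → r := (r :+ Q :* d) :- Q :* d) refl r Q (+ d) ⟩
    r ℤ.+ Q ℤ.* + d ℤ.- Q ℤ.* + d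
                   ≡⟨ cong (ℤ._- Q ℤ.* + d) (%ℕ-difference (x ℤ.+ + d) x d) ⟨
    (x ℤ.+ + d) ℤ.- x ℤ.- Q ℤ.* + d
                   ≡⟨ solve 3 (λ x Q d → (x :+ d) :- x :- Q :* d := (con (+ 1) :- Q) :* d) refl x Q (+ d) ⟩
    (+ 1 ℤ.- Q) ℤ.* + d ∎)
  (∣m-n∣<d (n%ℕd<d (x ℤ.+ + d) d) (n%ℕd<d x d))))
  where
  open ≡-Reasoning
  open ℤ-Solver using (solve; _:=_; _:+_; _:*_; _:-_; con)
  r Q : ℤ
  r = + ((x ℤ.+ + d) %ℕ d) ℤ.- + (x %ℕ d)
  Q = (x ℤ.+ + d) /ℕ d ℤ.- x /ℕ d

%ℕ-injective : ∀ {a b d} .{{_ : NonZero d}} n c → ℤ.∣ + a ℤ.- + b ∣ ℕ.< d →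
  (+ a ℤ.+ n ℤ.- c) %ℕ d ≡ (+ b ℤ.+ n ℤ.- c) %ℕ d → a ≡ b
%ℕ-injective {a} {b} {d} n c a-b<d e = ℤ.+-injective (ℤ.i-j≡0⇒i≡j _ _ (multiple<⇒≡0 {q = Q} (begin
    + a ℤ.- + b    ≡⟨ solve 4 (λ a b n c → a :- b := (a :+ n :- c) :- (b :+ n :- c)) refl (+ a) (+ b) n c ⟩
    x ℤ.- y        ≡⟨ %ℕ-difference x y d ⟩
    (+ (x %ℕ d) ℤ.- + (y %ℕ d)) ℤ.+ Q ℤ.* + d
                   ≡⟨ cong (ℤ._+ Q ℤ.* + d) (ℤ.i≡j⇒i-j≡0 (cong +_ e)) ⟩
    + 0 ℤ.+ Q ℤ.* + d ≡⟨ ℤ.+-identityˡ _ ⟩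
    Q ℤ.* + d ∎) a-b<d))
  where
  open ≡-Reasoning
  open ℤ-Solver using (solve; _:=_; _:+_; _:-_)
  x y Q : ℤ
  x = + a ℤ.+ n ℤ.- c
  y = + b ℤ.+ n ℤ.- c
  Q = x /ℕ d ℤ.- y /ℕ d

-- If y were missed, deleting it from the codomain by `punchOut` would inject a finite set into a
-- smaller one.
injective⇒surjective : ∀ {n} {f : Fin n → Fin n} → Injective _≡_ _≡_ f → ∀ y → ∃[ x ] f x ≡ y
injective⇒surjective {suc n} {f} f-inj y with any? (λ x → f x ≟ y)
... | yes found = found
... | no  none  = contradiction
  (injective⇒≤ {f = λ x → punchOut (y≢f x)} (λ {i} {j} e → f-inj (punchOut-injective (y≢f i) (y≢f j) e)))
  ℕ.1+n≰n
  where
  y≢f : ∀ x → y ≢ f x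
  y≢f x y≡fx = none (x , sym y≡fx)

module _ (n : ℤ) (k : ℕ) .{{_ : NonZero k}} where

  open ℤ-Solver using (solve; _:=_; _:+_; _:-_; con)

  private
    V : Set
    V = Fin (suc k)

  -- One more index than there are edges: index zero gives the vertex without outgoing edge.
  source : Fin (suc k) → V
  source i = fromℕ< (n%ℕd<d (+ toℕ i ℤ.+ n ℤ.- + 2) (suc k))

  toℕ-source : ∀ i → toℕ (source i) ≡ (+ toℕ i ℤ.+ n ℤ.- + 2) %ℕ suc k
  toℕ-source i = toℕ-fromℕ< (n%ℕd<d (+ toℕ i ℤ.+ n ℤ.- + 2) (suc k))

  target : Fin k → V
  target i = fromℕ< (ℕ.m<n⇒m<1+n (n%ℕd<d (+ index i ℤ.+ n ℤ.- + 1) k))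

  toℕ-target : ∀ i → toℕ (target i) ≡ (+ index i ℤ.+ n ℤ.- + 1) %ℕ k
  toℕ-target i = toℕ-fromℕ< (ℕ.m<n⇒m<1+n (n%ℕd<d (+ index i ℤ.+ n ℤ.- + 1) k))

  -- With index zero included these are k+1 consecutive integers modulo k+1, so `source` is a
  -- permutation of the vertices and `preimage` exists.
  source-injective : Injective _≡_ _≡_ source
  source-injective {i} {j} e = toℕ-injective (%ℕ-injective n (+ 2) (∣m-n∣<d (toℕ<n i) (toℕ<n j))
    (trans (sym (toℕ-source i)) (trans (cong toℕ e) (toℕ-source j))))

  target-injective : Injective _≡_ _≡_ target
  target-injective {i} {j} e = toℕ-injective (ℕ.suc-injective (%ℕ-injective n (+ 1)
    (subst (λ z → ℤ.∣ z ∣ ℕ.< k)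
      (solve 2 (λ a b → a :- b := (con (+ 1) :+ a) :- (con (+ 1) :+ b)) refl (+ toℕ i) (+ toℕ j))
      (∣m-n∣<d (toℕ<n i) (toℕ<n j)))
    (trans (sym (toℕ-target i)) (trans (cong toℕ e) (toℕ-target j)))))

  preimage : V → Fin (suc k)
  preimage a = proj₁ (injective⇒surjective source-injective a)

  source-preimage : ∀ a → source (preimage a) ≡ a
  source-preimage a = proj₂ (injective⇒surjective source-injective a)

  preimage-source : ∀ i → preimage (source i) ≡ i
  preimage-source i = source-injective (source-preimage (source i))

  next : Fin (suc k) → V
  next zero    = source zero
  next (suc i) = target i

  edge : ∀ i → G n k (source (suc i)) (target i)
  edge i = i , toℕ-source (suc i) , toℕ-target i

  edge⁻¹ : ∀ {a b} → G n k a b → ∃[ i ] a ≡ source (suc i) × b ≡ target i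
  edge⁻¹ (i , a≡ , b≡) = i , toℕ-injective (trans a≡ (sym (toℕ-source (suc i))))
                           , toℕ-injective (trans b≡ (sym (toℕ-target i)))

  isSuccessor : IsSuccessor (G n k) (source zero) (next ∘ preimage)
  isSuccessor = record
    { s-sink = cong next (preimage-source zero)
    ; ¬sink⟶ = λ a⟶b → let i , e , _ = edge⁻¹ a⟶b in 0≢1+n (source-injective e)
    ; ⟶⇒s    = ⟶⇒s
    ; s⇒⟶    = s⇒⟶
    ; s-inj  = s-inj
    }
    where
    ⟶⇒s : ∀ {a b} → G n k a b → next (preimage a) ≡ b
    ⟶⇒s a⟶b = let i , a≡ , b≡ = edge⁻¹ a⟶b in
      trans (cong next (trans (cong preimage a≡) (preimage-source (suc i)))) (sym b≡)

    next-edge : ∀ i → source i ≢ source zero → G n k (source i) (next i)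
    next-edge zero    e = contradiction refl e
    next-edge (suc i) _ = edge i

    next-injective : ∀ i j → source i ≢ source zero → source j ≢ source zero → next i ≡ next j → i ≡ j
    next-injective zero    _       p _ _ = contradiction refl p
    next-injective (suc _) zero    _ q _ = contradiction refl q
    next-injective (suc i) (suc j) _ _ e = cong suc (target-injective e)

    s⇒⟶ : ∀ {a} → a ≢ source zero → G n k a (next (preimage a))
    s⇒⟶ {a} a≢sink = subst (λ b → G n k b (next (preimage a))) (source-preimage a)
      (next-edge (preimage a) (a≢sink ∘ trans (sym (source-preimage a))))

    s-inj : ∀ {a b} → a ≢ source zero → b ≢ source zero → next (preimage a) ≡ next (preimage b) → a ≡ b
    s-inj {a} {b} a≢sink b≢sink e = trans (sym (source-preimage a)) (trans
      (cong source (next-injective (preimage a) (preimage b)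
        (a≢sink ∘ trans (sym (source-preimage a))) (b≢sink ∘ trans (sym (source-preimage b))) e))
      (source-preimage b))

  -- The integer ℓ = n + k + i - 1 of row i exceeds i + n - 2 by k+1, and i + n - 1 by k; hence its
  -- two residues are the endpoints of edge i.
  row-source : ∀ i → toℕ (source (suc i)) ≡ (n ℤ.+ + k ℤ.+ + index i ℤ.- + 1) %ℕ suc k
  row-source i = trans (toℕ-source (suc i)) (sym (trans
    (cong (_%ℕ suc k) (solve 3 (λ n k i →
      n :+ k :+ i :- con (+ 1) := (i :+ n :- con (+ 2)) :+ (con (+ 1) :+ k)) refl n (+ k) (+ index i)))
    (%ℕ-+d (+ index i ℤ.+ n ℤ.- + 2) (suc k))))

  row-target : ∀ i → toℕ (target i) ≡ (n ℤ.+ + k ℤ.+ + index i ℤ.- + 1) %ℕ k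
  row-target i = trans (toℕ-target i) (sym (trans
    (cong (_%ℕ k) (solve 3 (λ n k i →
      n :+ k :+ i :- con (+ 1) := (i :+ n :- con (+ 1)) :+ k) refl n (+ k) (+ index i)))
    (%ℕ-+d (+ index i ℤ.+ n ℤ.- + 1) k)))

open CauchyClosure
open ℚ-Solver using (solve; _:=_; _:+_; _:*_; _:-_; :-_; con)

-- Null sequences of rationals

IsNull : (ℕ → ℚ) → Set
IsNull u = ∀ ε → 0ℚ < ε → ∃[ N ] ∀ n → N ℕ.≤ n → ∣ u n ∣ < ε

null-resp : ∀ {u w} → (∀ n → u n ≡ w n) → IsNull u → IsNull w
null-resp e null ε ε>0 with N , p ← null ε ε>0 =
  N , λ n N≤n → subst (λ q → ∣ q ∣ < ε) (e n) (p n N≤n)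

null-+ : ∀ {u w} → IsNull u → IsNull w → IsNull (λ n → u n ℚ.+ w n)
null-+ {u} {w} nu nw ε ε>0
  with M , p ← nu (ε ℚ.* ½) (half-pos ε>0)
     | N , q ← nw (ε ℚ.* ½) (half-pos ε>0)
  = M ℕ.⊔ N , λ n l → begin-strict
    ∣ u n ℚ.+ w n ∣        ≤⟨ ℚ.∣p+q∣≤∣p∣+∣q∣ (u n) (w n) ⟩
    ∣ u n ∣ ℚ.+ ∣ w n ∣    <⟨ ℚ.+-mono-< (p n (ℕ.m⊔n≤o⇒m≤o M N l)) (q n (ℕ.m⊔n≤o⇒n≤o M N l)) ⟩
    ε ℚ.* ½ ℚ.+ ε ℚ.* ½    ≡⟨ half+half ε ⟩
    ε                      ∎
  where open ℚ.≤-Reasoning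

null-neg : ∀ {u} → IsNull u → IsNull (λ n → ℚ.- u n)
null-neg {u} nu ε ε>0 with N , p ← nu ε ε>0 =
  N , λ n N≤n → subst (_< ε) (sym (ℚ.∣-p∣≡∣p∣ (u n))) (p n N≤n)

null-* : ∀ {x u} → IsCauchy x → IsNull u → IsNull (λ n → x n ℚ.* u n)
null-* {x} {u} cx nu ε ε>0 =
  let B , B>0 , M , bound = eventually-bounded {x} cx
      δ , δ>0 , small = small-product B>0 ε>0
      N , p = nu δ δ>0
  in M ℕ.⊔ N , λ n l → small (x n) (u n) (bound n (ℕ.m⊔n≤o⇒m≤o M N l)) (p n (ℕ.m⊔n≤o⇒n≤o M N l))

-- The ring structure of ℝ and ℂ

≡⇒≈ℝ : ∀ {x y} → (∀ n → seq x n ≡ seq y n) → x ≈ℝ y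
≡⇒≈ℝ {x} {y} e ε ε>0 = 0 , λ n _ → subst (_< ε)
  (sym (cong ∣_∣ (trans (cong (ℚ._- seq y n) (e n)) (ℚ.+-inverseʳ (seq y n))))) ε>0

≈ℝ-sym : ∀ {x y} → x ≈ℝ y → y ≈ℝ x
≈ℝ-sym {x} {y} e = null-resp
  (λ n → solve 2 (λ a b → :- (a :- b) := b :- a) refl (seq x n) (seq y n)) (null-neg e)

≈ℝ-trans : ∀ {x y z} → x ≈ℝ y → y ≈ℝ z → x ≈ℝ z
≈ℝ-trans {x} {y} {z} e e′ = null-resp
  (λ n → solve 3 (λ a b c → (a :- b) :+ (b :- c) := a :- c) refl (seq x n) (seq y n) (seq z n))
  (null-+ e e′)

+ℝ-cong : ∀ {x y z w} → x ≈ℝ y → z ≈ℝ w → x +ℝ z ≈ℝ y +ℝ w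
+ℝ-cong {x} {y} {z} {w} e e′ = null-resp
  (λ n → solve 4 (λ a b c d → (a :- b) :+ (c :- d) := (a :+ c) :- (b :+ d)) refl
           (seq x n) (seq y n) (seq z n) (seq w n))
  (null-+ e e′)

-ℝ-cong : ∀ {x y} → x ≈ℝ y → -ℝ x ≈ℝ -ℝ y
-ℝ-cong {x} {y} e = null-resp
  (λ n → solve 2 (λ a b → :- (a :- b) := (:- a) :- (:- b)) refl (seq x n) (seq y n)) (null-neg e)

*ℝ-cong : ∀ {x y z w} → x ≈ℝ y → z ≈ℝ w → x *ℝ z ≈ℝ y *ℝ w
*ℝ-cong {x} {y} {z} {w} e e′ = null-resp
  (λ n → solve 4 (λ a b c d → a :* (c :- d) :+ d :* (a :- b) := a :* c :- b :* d) refl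
           (seq x n) (seq y n) (seq z n) (seq w n))
  (null-+ (null-* {seq x} (cauchy x) e′) (null-* {seq w} (cauchy w) e))

≡⇒≈ℂ : ∀ {z w} → (∀ n → seq (re z) n ≡ seq (re w) n) → (∀ n → seq (im z) n ≡ seq (im w) n) → z ≈ℂ w
≡⇒≈ℂ {z} {w} e e′ = ≡⇒≈ℝ {re z} {re w} e , ≡⇒≈ℝ {im z} {im w} e′

-- The algebraic laws hold term by term as identities in `ℚ`; null sequences enter only in the
-- equivalence and congruence laws.
ℂ-isCommutativeRing : IsCommutativeRing _≈ℂ_ _+ℂ_ _*ℂ_ -ℂ_ 0# 1#
ℂ-isCommutativeRing = record
  { isRing = record
    { +-isAbelianGroup = record
      { isGroup = record
        { isMonoid = record
          { isSemigroup = record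
            { isMagma = record
              { isEquivalence = record
                { refl  = λ {z} → ≡⇒≈ℂ {z} {z} (λ _ → refl) (λ _ → refl)
                ; sym   = λ {z} {w} (e , e′) →
                    ≈ℝ-sym {re z} {re w} e , ≈ℝ-sym {im z} {im w} e′
                ; trans = λ {z} {w} {u} (e , e′) (d , d′) →
                    ≈ℝ-trans {re z} {re w} {re u} e d , ≈ℝ-trans {im z} {im w} {im u} e′ d′
                }
              ; ∙-cong = λ {z} {w} {u} {t} (e , e′) (d , d′) →
                  +ℝ-cong {re z} {re w} {re u} {re t} e d , +ℝ-cong {im z} {im w} {im u} {im t} e′ d′
              }
            ; assoc = λ z w u → ≡⇒≈ℂ {(z +ℂ w) +ℂ u} {z +ℂ (w +ℂ u)}
                (λ n → ℚ.+-assoc (seq (re z) n) _ _) (λ n → ℚ.+-assoc (seq (im z) n) _ _)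
            }
          ; identity =
              (λ z → ≡⇒≈ℂ {0# +ℂ z} {z} (λ n → ℚ.+-identityˡ _) (λ n → ℚ.+-identityˡ _))
            , (λ z → ≡⇒≈ℂ {z +ℂ 0#} {z} (λ n → ℚ.+-identityʳ _) (λ n → ℚ.+-identityʳ _))
          }
        ; inverse =
            (λ z → ≡⇒≈ℂ { -ℂ z +ℂ z} {0#} (λ n → ℚ.+-inverseˡ (seq (re z) n)) (λ n → ℚ.+-inverseˡ (seq (im z) n)))
          , (λ z → ≡⇒≈ℂ {z +ℂ -ℂ z} {0#} (λ n → ℚ.+-inverseʳ (seq (re z) n)) (λ n → ℚ.+-inverseʳ (seq (im z) n)))
        ; ⁻¹-cong = λ {z} {w} (e , e′) → -ℝ-cong {re z} {re w} e , -ℝ-cong {im z} {im w} e′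
        }
      ; comm = λ z w → ≡⇒≈ℂ {z +ℂ w} {w +ℂ z}
          (λ n → ℚ.+-comm (seq (re z) n) _) (λ n → ℚ.+-comm (seq (im z) n) _)
      }
    ; *-cong = λ {z} {w} {u} {t} (e , e′) (d , d′) →
        +ℝ-cong {re z *ℝ re u} {re w *ℝ re t} { -ℝ (im z *ℝ im u)} { -ℝ (im w *ℝ im t)}
          (*ℝ-cong {re z} {re w} {re u} {re t} e d)
          (-ℝ-cong {im z *ℝ im u} {im w *ℝ im t} (*ℝ-cong {im z} {im w} {im u} {im t} e′ d′))
      , +ℝ-cong {re z *ℝ im u} {re w *ℝ im t} {im z *ℝ re u} {im w *ℝ re t}
          (*ℝ-cong {re z} {re w} {im u} {im t} e d′)
          (*ℝ-cong {im z} {im w} {re u} {re t} e′ d)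
    ; *-assoc = λ z w u → ≡⇒≈ℂ {(z *ℂ w) *ℂ u} {z *ℂ (w *ℂ u)}
        (λ n → solve 6 (λ a b c d e f →
            (a :* c :- b :* d) :* e :- (a :* d :+ b :* c) :* f :=
            a :* (c :* e :- d :* f) :- b :* (c :* f :+ d :* e)) refl
          (seq (re z) n) (seq (im z) n) (seq (re w) n) (seq (im w) n) (seq (re u) n) (seq (im u) n))
        (λ n → solve 6 (λ a b c d e f →
            (a :* c :- b :* d) :* f :+ (a :* d :+ b :* c) :* e :=
            a :* (c :* f :+ d :* e) :+ b :* (c :* e :- d :* f)) refl
          (seq (re z) n) (seq (im z) n) (seq (re w) n) (seq (im w) n) (seq (re u) n) (seq (im u) n))
    ; *-identity =
        (λ z → ≡⇒≈ℂ {1# *ℂ z} {z}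
          (λ n → solve 2 (λ a b → con 1ℚ :* a :- con 0ℚ :* b := a) refl (seq (re z) n) (seq (im z) n))
          (λ n → solve 2 (λ a b → con 1ℚ :* b :+ con 0ℚ :* a := b) refl (seq (re z) n) (seq (im z) n)))
      , (λ z → ≡⇒≈ℂ {z *ℂ 1#} {z}
          (λ n → solve 2 (λ a b → a :* con 1ℚ :- b :* con 0ℚ := a) refl (seq (re z) n) (seq (im z) n))
          (λ n → solve 2 (λ a b → a :* con 0ℚ :+ b :* con 1ℚ := b) refl (seq (re z) n) (seq (im z) n)))
    ; distrib =
        (λ z w u → ≡⇒≈ℂ {z *ℂ (w +ℂ u)} {z *ℂ w +ℂ z *ℂ u}
          (λ n → solve 6 (λ a b c d e f →
              a :* (c :+ e) :- b :* (d :+ f) := (a :* c :- b :* d) :+ (a :* e :- b :* f)) refl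
            (seq (re z) n) (seq (im z) n) (seq (re w) n) (seq (im w) n) (seq (re u) n) (seq (im u) n))
          (λ n → solve 6 (λ a b c d e f →
              a :* (d :+ f) :+ b :* (c :+ e) := (a :* d :+ b :* c) :+ (a :* f :+ b :* e)) refl
            (seq (re z) n) (seq (im z) n) (seq (re w) n) (seq (im w) n) (seq (re u) n) (seq (im u) n)))
      , (λ z w u → ≡⇒≈ℂ {(w +ℂ u) *ℂ z} {w *ℂ z +ℂ u *ℂ z}
          (λ n → solve 6 (λ a b c d e f →
              (c :+ e) :* a :- (d :+ f) :* b := (c :* a :- d :* b) :+ (e :* a :- f :* b)) refl
            (seq (re z) n) (seq (im z) n) (seq (re w) n) (seq (im w) n) (seq (re u) n) (seq (im u) n))
          (λ n → solve 6 (λ a b c d e f →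
              (c :+ e) :* b :+ (d :+ f) :* a := (c :* b :+ d :* a) :+ (e :* b :+ f :* a)) refl
            (seq (re z) n) (seq (im z) n) (seq (re w) n) (seq (im w) n) (seq (re u) n) (seq (im u) n)))
    }
  ; *-comm = λ z w → ≡⇒≈ℂ {z *ℂ w} {w *ℂ z}
      (λ n → solve 4 (λ a b c d → a :* c :- b :* d := c :* a :- d :* b) refl
        (seq (re z) n) (seq (im z) n) (seq (re w) n) (seq (im w) n))
      (λ n → solve 4 (λ a b c d → a :* d :+ b :* c := c :* b :+ d :* a) refl
        (seq (re z) n) (seq (im z) n) (seq (re w) n) (seq (im w) n))
  }

ℂ-commutativeRing : CommutativeRing 0ℓ 0ℓ
ℂ-commutativeRing = record { isCommutativeRing = ℂ-isCommutativeRing }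

-- Cancellation

-- The overlapping alternatives are what makes this decidable: beyond N the sequence varies by less
-- than ε/4, so comparing the single rational `∣ y N ∣` with ε/2 leaves every later term either
-- below 3ε/4 or at least ε/4 in absolute value.
small-or-apart : ∀ {y} → IsCauchy y → ∀ ε → 0ℚ < ε →
  (∃[ N ] ∀ n → N ℕ.≤ n → ∣ y n ∣ < ε) ⊎
  (∃[ δ ] 0ℚ < δ × ∃[ N ] ∀ n → N ℕ.≤ n → δ ≤ ∣ y n ∣)
small-or-apart {y} cy ε ε>0 with cy (ε ℚ.* ½ ℚ.* ½) (half-pos (half-pos ε>0))
... | N , close with ∣ y N ∣ ℚ.<? ε ℚ.* ½
...   | yes small = inj₁ (N , λ n N≤n → begin-strict
    ∣ y n ∣                       ≡⟨ cong ∣_∣ (solve 2 (λ a b → a := (a :- b) :+ b) refl (y n) (y N)) ⟩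
    ∣ (y n ℚ.- y N) ℚ.+ y N ∣     ≤⟨ ℚ.∣p+q∣≤∣p∣+∣q∣ (y n ℚ.- y N) (y N) ⟩
    ∣ y n ℚ.- y N ∣ ℚ.+ ∣ y N ∣   <⟨ ℚ.+-mono-< (close n N N≤n ℕ.≤-refl) small ⟩
    δ ℚ.+ ε ℚ.* ½                 ≤⟨ ℚ.+-monoˡ-≤ (ε ℚ.* ½) δ≤ ⟩
    ε ℚ.* ½ ℚ.+ ε ℚ.* ½           ≡⟨ half+half ε ⟩
    ε                             ∎)
  where
  open ℚ.≤-Reasoning
  δ = ε ℚ.* ½ ℚ.* ½
  δ≤ : δ ≤ ε ℚ.* ½
  δ≤ = begin
    δ          ≡⟨ ℚ.+-identityʳ δ ⟨
    δ ℚ.+ 0ℚ   ≤⟨ ℚ.+-monoʳ-≤ δ (ℚ.<⇒≤ (half-pos (half-pos ε>0))) ⟩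
    δ ℚ.+ δ    ≡⟨ half+half (ε ℚ.* ½) ⟩
    ε ℚ.* ½    ∎
...   | no large = inj₂ (δ , half-pos (half-pos ε>0) , N , λ n N≤n → ℚ.≮⇒≥ (λ yn<δ → large (begin-strict
    ∣ y N ∣                       ≡⟨ cong ∣_∣ (solve 2 (λ a b → a := (a :- b) :+ b) refl (y N) (y n)) ⟩
    ∣ (y N ℚ.- y n) ℚ.+ y n ∣     ≤⟨ ℚ.∣p+q∣≤∣p∣+∣q∣ (y N ℚ.- y n) (y n) ⟩
    ∣ y N ℚ.- y n ∣ ℚ.+ ∣ y n ∣   <⟨ ℚ.+-mono-< (close N n ℕ.≤-refl N≤n) yn<δ ⟩
    δ ℚ.+ δ                       ≡⟨ half+half (ε ℚ.* ½) ⟩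
    ε ℚ.* ½                       ∎)))
  where
  open ℚ.≤-Reasoning
  δ = ε ℚ.* ½ ℚ.* ½

pos*pos : ∀ {p q} → 0ℚ < p → 0ℚ < q → 0ℚ < p ℚ.* q
pos*pos {p} {q} p>0 q>0 =
  ℚ.positive⁻¹ (p ℚ.* q) {{ℚ.pos*pos⇒pos p {{positive p>0}} q {{positive q>0}}}}

-- If y were not small, it would be bounded away from zero, which forces x to be null.
null-cancel : ∀ {x y} → IsCauchy y → IsNull (λ n → x n ℚ.* y n) → ¬ IsNull x → IsNull y
null-cancel {x} {y} cy nxy ¬nx ε ε>0 with small-or-apart {y} cy ε ε>0
... | inj₁ small = small
... | inj₂ (δ , δ>0 , M , apart) = contradiction nx ¬nx
  where
  open ℚ.≤-Reasoning
  nx : IsNull x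
  nx η η>0 with N , p ← nxy (η ℚ.* δ) (pos*pos η>0 δ>0) = M ℕ.⊔ N , λ n l →
    ℚ.*-cancelʳ-<-nonNeg δ {{nonNegative (ℚ.<⇒≤ δ>0)}} (begin-strict
      ∣ x n ∣ ℚ.* δ         ≤⟨ ℚ.*-monoˡ-≤-nonNeg ∣ x n ∣ {{ℚ.∣-∣-nonNeg (x n)}} (apart n (ℕ.m⊔n≤o⇒m≤o M N l)) ⟩
      ∣ x n ∣ ℚ.* ∣ y n ∣   ≡⟨ ℚ.∣p*q∣≡∣p∣*∣q∣ (x n) (y n) ⟨
      ∣ x n ℚ.* y n ∣       <⟨ p n (ℕ.m⊔n≤o⇒n≤o M N l) ⟩
      η ℚ.* δ               ∎)

0≤p*p : ∀ p → 0ℚ ≤ p ℚ.* p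
0≤p*p p with ℚ.≤-total 0ℚ p
... | inj₁ 0≤p = ℚ.≤-trans (ℚ.≤-reflexive (sym (ℚ.*-zeroˡ p)))
  (ℚ.*-monoʳ-≤-nonNeg p {{nonNegative 0≤p}} 0≤p)
... | inj₂ p≤0 = ℚ.≤-trans (ℚ.≤-reflexive (sym (ℚ.*-zeroˡ p)))
  (ℚ.*-monoʳ-≤-nonPos p {{ℚ.nonPositive p≤0}} p≤0)

null-sumOfSquaresˡ : ∀ {x y : ℕ → ℚ} → IsNull (λ n → x n ℚ.* x n ℚ.+ y n ℚ.* y n) → IsNull x
null-sumOfSquaresˡ {x} {y} nxy ε ε>0 with N , p ← nxy (ε ℚ.* ε) (pos*pos ε>0 ε>0) =
  N , λ n N≤n → ℚ.≰⇒> (λ ε≤ → ℚ.<-irrefl refl (begin-strict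
    ε ℚ.* ε                             ≤⟨ ℚ.*-monoˡ-≤-nonNeg ε {{nonNegative (ℚ.<⇒≤ ε>0)}} ε≤ ⟩
    ε ℚ.* ∣ x n ∣                       ≤⟨ ℚ.*-monoʳ-≤-nonNeg ∣ x n ∣ {{ℚ.∣-∣-nonNeg (x n)}} ε≤ ⟩
    ∣ x n ∣ ℚ.* ∣ x n ∣                 ≡⟨ ℚ.∣p*q∣≡∣p∣*∣q∣ (x n) (x n) ⟨
    ∣ x n ℚ.* x n ∣                     ≡⟨ ℚ.0≤p⇒∣p∣≡p (0≤p*p (x n)) ⟩
    x n ℚ.* x n                         ≡⟨ ℚ.+-identityʳ (x n ℚ.* x n) ⟨
    x n ℚ.* x n ℚ.+ 0ℚ                  ≤⟨ ℚ.+-monoʳ-≤ (x n ℚ.* x n) (0≤p*p (y n)) ⟩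
    x n ℚ.* x n ℚ.+ y n ℚ.* y n         ≡⟨ ℚ.0≤p⇒∣p∣≡p (ℚ.+-mono-≤ (0≤p*p (x n)) (0≤p*p (y n))) ⟨
    ∣ x n ℚ.* x n ℚ.+ y n ℚ.* y n ∣     <⟨ p n N≤n ⟩
    ε ℚ.* ε                             ∎))
  where open ℚ.≤-Reasoning

≈0⇒null : ∀ {x} → x ≈ℝ fromℚ 0ℚ → IsNull (seq x)
≈0⇒null {x} = null-resp (λ n → ℚ.+-identityʳ (seq x n))

null⇒≈0 : ∀ {x} → IsNull (seq x) → x ≈ℝ fromℚ 0ℚ
null⇒≈0 {x} = null-resp (λ n → sym (ℚ.+-identityʳ (seq x n)))

-- Multiplying z w by the conjugate of z reduces the claim to the real numbers |z|², Re w and Im w.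
*ℂ-cancel-0 : ∀ z w → ¬ z ≈ℂ 0# → z *ℂ w ≈ℂ 0# → w ≈ℂ 0#
*ℂ-cancel-0 z w z≉0 (e , e′) =
    null⇒≈0 {re w} (null-cancel {norm} {c} (cauchy (re w)) norm*c norm≉0)
  , null⇒≈0 {im w} (null-cancel {norm} {d} (cauchy (im w)) norm*d norm≉0)
  where
  a b c d norm : ℕ → ℚ
  a = seq (re z)
  b = seq (im z)
  c = seq (re w)
  d = seq (im w)
  norm n = a n ℚ.* a n ℚ.+ b n ℚ.* b n

  norm≉0 : ¬ IsNull norm
  norm≉0 nn = z≉0
    ( null⇒≈0 {re z} (null-sumOfSquaresˡ {a} {b} nn)
    , null⇒≈0 {im z} (null-sumOfSquaresˡ {b} {a} (null-resp (λ n → ℚ.+-comm (a n ℚ.* a n) (b n ℚ.* b n)) nn)) )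

  nre : IsNull (seq (re (z *ℂ w)))
  nre = ≈0⇒null {re (z *ℂ w)} e

  nim : IsNull (seq (im (z *ℂ w)))
  nim = ≈0⇒null {im (z *ℂ w)} e′

  norm*c : IsNull (λ n → norm n ℚ.* c n)
  norm*c = null-resp
    (λ n → solve 4 (λ a b c d → a :* (a :* c :- b :* d) :+ b :* (a :* d :+ b :* c) :=
                                (a :* a :+ b :* b) :* c) refl (a n) (b n) (c n) (d n))
    (null-+ (null-* {a} {seq (re (z *ℂ w))} (cauchy (re z)) nre) (null-* {b} {seq (im (z *ℂ w))} (cauchy (im z)) nim))

  norm*d : IsNull (λ n → norm n ℚ.* d n)
  norm*d = null-resp
    (λ n → solve 4 (λ a b c d → a :* (a :* d :+ b :* c) :+ :- (b :* (a :* c :- b :* d)) :=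
                                (a :* a :+ b :* b) :* d) refl (a n) (b n) (c n) (d n))
    (null-+ (null-* {a} {seq (im (z *ℂ w))} (cauchy (re z)) nim)
            (null-neg (null-* {b} {seq (re (z *ℂ w))} (cauchy (im z)) nre)))

suc×1-invertible : ∀ k → ∃[ ι ] (suc k ×ℂ 1#) *ℂ ι ≈ℂ 1#
suc×1-invertible k = ι , ≡⇒≈ℂ {(suc k ×ℂ 1#) *ℂ ι} {1#}
  (λ n → trans (cong₂ (λ p q → p ℚ.* q⁻¹ ℚ.- q ℚ.* 0ℚ) (re-× (suc k) n) (im-× (suc k) n))
           (trans (solve 1 (λ p → p :- con 0ℚ :* con 0ℚ := p) refl (q ℚ.* q⁻¹)) (ℚ.*-inverseʳ q)))
  (λ n → trans (cong (λ p → seq (re (suc k ×ℂ 1#)) n ℚ.* 0ℚ ℚ.+ p ℚ.* q⁻¹) (im-× (suc k) n))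
           (solve 2 (λ p r → p :* con 0ℚ :+ con 0ℚ :* r := con 0ℚ) refl (seq (re (suc k ×ℂ 1#)) n) q⁻¹))
  where
  fromℕ : ℕ → ℚ
  fromℕ zero    = 0ℚ
  fromℕ (suc m) = 1ℚ ℚ.+ fromℕ m

  fromℕ≥0 : ∀ m → 0ℚ ≤ fromℕ m
  fromℕ≥0 zero    = ℚ.≤-refl
  fromℕ≥0 (suc m) = ℚ.+-mono-≤ (ℚ.nonNegative⁻¹ 1ℚ) (fromℕ≥0 m)

  q : ℚ
  q = fromℕ (suc k)

  instance
    q≢0 : ℚ.NonZero q
    q≢0 = ℚ.pos⇒nonZero q {{positive (ℚ.+-mono-<-≤ (ℚ.positive⁻¹ 1ℚ) (fromℕ≥0 k))}}

  q⁻¹ : ℚ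
  q⁻¹ = ℚ.1/ q

  ι : ℂ
  ι = fromℚ q⁻¹ +i fromℚ 0ℚ

  re-× : ∀ m n → seq (re (m ×ℂ 1#)) n ≡ fromℕ m
  re-× zero    n = refl
  re-× (suc m) n = cong (1ℚ ℚ.+_) (re-× m n)

  im-× : ∀ m n → seq (im (m ×ℂ 1#)) n ≡ 0ℚ
  im-× zero    n = refl
  im-× (suc m) n = cong (0ℚ ℚ.+_) (im-× m n)

-- The kernel of H

nullity : ∀ k .{{_ : NonZero k}} n ξ → IsPrimitiveRoot (suc k) ξ → ∀ ι → (suc k ×ℂ 1#) *ℂ ι ≈ℂ 1# →
  (C : Components (G n k)) → HasNullity (H n k ξ) (Components.count C)
nullity k n ξ (ξ^[1+k]≈1 , ξ^j≉1) ι ι-inverse C = B.basis , record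
  { member      = λ b i → D.values-≈⇒row-≈0 (H n k ξ i) (source n k (suc i)) (target n k i) (row i)
      (B.basis b) (B.basis-values b (comp-edge (edge n k i)))
  ; independent = B.basis-independent
  -- The equivalence given to `to-rep` is `≈ℂ` pulled back along `D.values x`; the kernel equations
  -- say that it contains every edge.
  ; spanning    = λ x x∈ker → B.basis-spanning x (to-rep
      (On.isEquivalence (D.values x) isEquivalence)
      (λ a⟶b → invariant x x∈ker (edge⁻¹ n k a⟶b)))
  }
  where
  open Components C
  open CommutativeRing ℂ-commutativeRing using (isEquivalence)
  module D = Fourier.Transform ℂ-commutativeRing *ℂ-cancel-0 k ξ ξ^[1+k]≈1 ξ^j≉1 ι ι-inverse
  module B = D.Basis comp rep comp-rep

  row : ∀ i j → H n k ξ i j ≡ D.χ (suc j) (source n k (suc i)) -ℂ D.χ (suc j) (target n k i)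
  row i j = cong₂ (λ p q → v ξ p j -ℂ v ξ q j) (sym (row-source n k i)) (sym (row-target n k i))

  invariant : ∀ x → InKernel (H n k ξ) x → ∀ {a b} →
    ∃[ i ] a ≡ source n k (suc i) × b ≡ target n k i → D.values x a ≈ℂ D.values x b
  invariant x x∈ker (i , refl , refl) =
    D.row-≈0⇒values-≈ (H n k ξ i) (source n k (suc i)) (target n k i) (row i) x (x∈ker i)

theorem2p1 : (k : ℕ) .{{_ : NonZero k}} (n : ℤ) (ξ : ℂ) → IsPrimitiveRoot (suc k) ξ →
    ∃[ d ] HasNullity (H n k ξ) d × HasCycleCount (G n k) d
theorem2p1 k n ξ ξ-primitive =
  count , nullity k n ξ ξ-primitive (proj₁ inverse) (proj₂ inverse) C , cycleCount
  where
  C = components (isSuccessor n k)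
  open Components C
  inverse = suc×1-invertible k
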